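{- $\le_T^{RS}\neq \le_T^{O}$ (as sets of pairs $(A,B)$ with $A\le B$).
   Context: An NPTM is a nondeterministic oracle Turing machine $N$ each of whose computation paths ends in one of three outcomes $\mathbf{acc}$, $\mathbf{rej}$, $\mathbf{?}$, such that there is a polynomial $p$ with: for every oracle $D$ and every input $x$, every computation path of $N^D(x)$ has length at most $p(|x|)$. For an oracle $D$ and input $x$, let $out_{N^D}(x)$ be the set of outcomes occurring on some path of $N^D(x)$; $L(N^D)=\{x:\mathbf{acc}\in out_{N^D}(x)\}$. $N^D(x)$ is underproductive if $\{\mathbf{acc},\mathbf{rej}\}\not\subseteq out_{N^D}(x)$, and overproductive if $out_{N^D}(x)\neq\{\mathbf{?}\}$; $N^D$ is underproductive (overproductive) if $N^D(x)$ is so for every $x$. $N$ is robustly underproductive (overproductive) if $N^D$ is underproductive (overproductive) for every oracle $D$. $A\le_T^{SN}B$ if there is an NPTM $N$ with $N^B$ both overproductive and underproductive and $A=L(N^B)$. $A\le_T^{RS}B$ if $A\le_T^{SN}B$ via an $N$ that is both robustly overproductive and robustly underproductive. $A\le_T^{O}B$ if $A\le_T^{SN}B$ via an $N$ that is robustly overproductive. -}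

module Defs where

open import Data.Nat using (ℕ; zero; suc; _+_; _*_; _^_; _≤_)
open import Data.Fin using (Fin)
open import Data.Bool using (Bool; true; false; if_then_else_)
open import Data.List using (List; []; _∷_; reverse; _++_; length)
open import Data.List.NonEmpty using (List⁺; toList)
open import Data.List.Membership.Propositional using (_∈_)
open import Data.Product using (Σ; _×_; _,_; ∃)
open import Data.Sum using (_⊎_)
open import Relation.Binary.PropositionalEquality using (_≡_)
open import Relation.Nullary using (¬_)
open import Function.Bundles using (_⇔_)

Str : Set
Str = List Bool

Lang : Set
Lang = Str → Bool

-- Machine model: nondeterministic oracle Turing machines with a
-- one-sided work tape (holding the input initially) and a one-sided
-- query tape.  Tape alphabet Fin (3 + m): symbol 0 = blank,
-- symbol 1 = bit 0, symbol 2 = bit 1, further symbols arbitrary.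

data Outcome : Set where
  acc rej unk : Outcome

data Move : Set where
  L R S : Move

data Kind : Set where
  normal query : Kind
  halt : Outcome → Kind

record NOTM : Set where
  field
    nSt    : ℕ
    m      : ℕ
    start  : Fin (suc nSt)
    qYes   : Fin (suc nSt)
    qNo    : Fin (suc nSt)
    kind   : Fin (suc nSt) → Kind
    -- transition relation for normal states: given the state and the
    -- two scanned symbols (work, query), a nonempty list of choices
    -- (new state, symbol written on work tape, work-head move,
    --  symbol written on query tape, query-head move)
    δ      : Fin (suc nSt) → Fin (3 + m) → Fin (3 + m) →
             List⁺ (Fin (suc nSt) × Fin (3 + m) × Move × Fin (3 + m) × Move)

module _ (N : NOTM) where
  open NOTM N

  Sym : Set
  Sym = Fin (3 + m)

  St : Set
  St = Fin (suc nSt)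

  blank : Sym
  blank = Fin.zero
    where import Data.Fin as Fin

  bitSym : Bool → Sym
  bitSym false = Data.Fin.suc Data.Fin.zero
  bitSym true  = Data.Fin.suc (Data.Fin.suc Data.Fin.zero)

  -- one-sided tape: cells left of the head (reversed), scanned cell,
  -- cells right of the head; unvisited cells are blank
  record Tape : Set where
    constructor tape
    field
      left  : List Sym
      cur   : Sym
      right : List Sym

  emptyTape : Tape
  emptyTape = tape [] blank []

  writeMove : Sym → Move → Tape → Tape
  writeMove s L (tape [] _ r)      = tape [] s r
  writeMove s L (tape (a ∷ l) _ r) = tape l a (s ∷ r)
  writeMove s R (tape l _ [])      = tape (s ∷ l) blank []
  writeMove s R (tape l _ (a ∷ r)) = tape (s ∷ l) a r
  writeMove s S (tape l _ r)       = tape l s r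

  contents : Tape → List Sym
  contents (tape l c r) = reverse l ++ (c ∷ r)

  readBits : List Sym → Str
  readBits [] = []
  readBits (Data.Fin.zero ∷ _) = []
  readBits (Data.Fin.suc Data.Fin.zero ∷ s) = false ∷ readBits s
  readBits (Data.Fin.suc (Data.Fin.suc Data.Fin.zero) ∷ s) = true ∷ readBits s
  readBits (Data.Fin.suc (Data.Fin.suc (Data.Fin.suc _)) ∷ _) = []

  record Config : Set where
    constructor cfg
    field
      state : St
      work  : Tape
      qtape : Tape

  inputTape : Str → Tape
  inputTape []      = emptyTape
  inputTape (b ∷ x) = tape [] (bitSym b) (Data.List.map bitSym x)
    where import Data.List

  initCfg : Str → Config
  initCfg x = cfg start (inputTape x) emptyTape

  apply : Config → (St × Sym × Move × Sym × Move) → Config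
  apply (cfg _ w qt) (q' , sw , mw , sq , mq) =
    cfg q' (writeMove sw mw w) (writeMove sq mq qt)

  data Step (D : Lang) : Config → Config → Set where
    move : ∀ {q w qt t} → kind q ≡ normal →
           t ∈ toList (δ q (Tape.cur w) (Tape.cur qt)) →
           Step D (cfg q w qt) (apply (cfg q w qt) t)
    ask  : ∀ {q w qt} → kind q ≡ query →
           Step D (cfg q w qt)
                  (cfg (if D (readBits (contents qt)) then qYes else qNo)
                       w emptyTape)

  data Steps (D : Lang) : ℕ → Config → Config → Set where
    done : ∀ {c} → Steps D 0 c c
    step : ∀ {k c c' c''} → Step D c c' → Steps D k c' c'' →
           Steps D (suc k) c c''

  -- o ∈ out_{N^D}(x): some computation path of N^D(x) ends with outcome o
  -- (halting states have no successors, so reachable halting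
  --  configurations are exactly ends of computation paths)
  Out : Lang → Str → Outcome → Set
  Out D x o = Σ ℕ λ k → Σ Config λ c →
              Steps D k (initCfg x) c × kind (Config.state c) ≡ halt o

-- N is an NPTM: a single polynomial bound (c * n ^ d + c) on the length
-- of every computation path, for every oracle and every input.
-- (Every non-halting configuration has a successor since δ yields
--  nonempty lists, so every path ends in an outcome.)
IsNPTM : NOTM → Set
IsNPTM N = Σ ℕ λ c → Σ ℕ λ d → ∀ (D : Lang) (x : Str) k c' →
           Steps N D k (initCfg N x) c' → k ≤ c * length x ^ d + c

Decides : NOTM → Lang → Lang → Set
Decides N D A = ∀ x → (A x ≡ true) ⇔ Out N D x acc

Underproductive : NOTM → Lang → Set
Underproductive N D = ∀ x → ¬ (Out N D x acc × Out N D x rej)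

-- out ≠ {?}; since out is never empty, this means acc or rej occurs
Overproductive : NOTM → Lang → Set
Overproductive N D = ∀ x → Out N D x acc ⊎ Out N D x rej

RobustlyUnderproductive : NOTM → Set
RobustlyUnderproductive N = ∀ D → Underproductive N D

RobustlyOverproductive : NOTM → Set
RobustlyOverproductive N = ∀ D → Overproductive N D

SNvia : NOTM → Lang → Lang → Set
SNvia N A B = IsNPTM N × Overproductive N B × Underproductive N B × Decides N B A

_≤SN_ : Lang → Lang → Set
A ≤SN B = Σ NOTM λ N → SNvia N A B

_≤RS_ : Lang → Lang → Set
A ≤RS B = Σ NOTM λ N → SNvia N A B × RobustlyOverproductive N × RobustlyUnderproductive N

_≤O_ : Lang → Lang → Set
A ≤O B = Σ NOTM λ N → SNvia N A B × RobustlyOverproductive N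

{-# OPTIONS --safe #-}
module Submission where

-- The total search problem is the sink of an increasing path on {0, …, 2ⁿ - 1} starting
-- at 0: for every oracle either the path stops at some z, certified by three queries, or
-- the oracle visibly misbehaves, so answering by the parity of z is robustly
-- overproductive, and on honest paths it is also underproductive.  No robustly
-- underproductive machine N decides this parity in time t: each accepting computation on
-- an instance must contradict, at some revealed row, every rejecting computation on any
-- other instance (else a hybrid oracle has both).  An adversary keeps the end of the path
-- unrevealed, so after t + 1 accepting computations a rejecting one would need more than
-- t queries.  Diagonalising over all clocked machines gives the oracle.

-- A hybrid of two honest instances is in general not an instance, since it may have two sinks, so
-- correctness of `N` says nothing about it; only underproductivity on every oracle does. This is
-- the one place where the two reductions differ. A query is a threshold question about one row of
-- `f`, but the adversary counts the whole row as revealed, so a path of length `t` reveals at most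
-- `t` rows and leaves the hybrids easy to describe. The rows on which one rejecting path meets the
-- successive accepting paths are distinct, because each round demands a row that was not revealed
-- in the rounds before it; so that single path pays one query per round. The end of the path stays
-- free because each round moves it by an amount linear in the number of revealed rows, while
-- exponentially many points are available. Everything is decidable within the time bound, so the
-- adversary is an algorithm that returns a concrete instance for the diagonalisation.

open import Defs
open import Data.Bool using (Bool; true; false; not; _∧_; _xor_; if_then_else_; T)
open import Data.Bool.Properties using (¬-not)
open import Data.Empty using (⊥-elim)
open import Data.Fin using (Fin; zero; suc; toℕ; #_)
open import Data.Fin.Properties using (pigeonhole; ¬∀⟶∃¬; toℕ-injective; toℕ-fromℕ<; toℕ<n; toℕ≤pred[n]; <⇒≢)
open import Data.List using (List; []; _∷_; [_]; length; map; filter; _++_; _ʳ++_; reverse; drop; replicate; zip; lookup; tabulate)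
open import Data.List.Properties using (length-++; length-reverse; length-map; length-filter; length-replicate; map-cong; tabulate-cong; tabulate-lookup; ʳ++-defn; reverse-map; reverse-involutive)
open import Data.List.Membership.Propositional using (_∈_; _∉_; find; lose)
open import Data.List.Membership.Propositional.Properties using (∈-map⁺; ∈-map⁻; ∈-++⁺ˡ; ∈-++⁺ʳ)
open import Data.List.NonEmpty using (List⁺; _∷_; toList; head; tail)
open import Data.List.Relation.Unary.Any using (Any; here; there; any?; index)
open import Data.List.Relation.Unary.Any.Properties using (lookup-index)
open import Data.Maybe using (Maybe; just; nothing)
open import Data.Nat
open import Data.Nat.DivMod using (_mod_; m<n⇒m%n≡m)
open import Data.Nat.Properties hiding (<⇒≢)
open import Data.Nat.Tactic.RingSolver using (solve-∀)
open import Data.List.Membership.DecPropositional _≟_ using (_∈?_)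
open import Data.Product using (Σ; ∃; _×_; _,_; proj₁; proj₂)
open import Data.Sum using (_⊎_; inj₁; inj₂)
open import Data.Unit using (⊤; tt)
open import Function using (_∘_; id)
open import Function.Bundles using (_⇔_; mk⇔; Equivalence)
open import Relation.Binary.PropositionalEquality hiding ([_])
open import Relation.Nullary using (¬_; Dec; yes; no; contradiction)
open import Relation.Nullary.Decidable using (map′; ¬?; _×-dec_; decidable-stable)

-- Computation paths

_≟ᵏ_ : (k k′ : Kind) → Dec (k ≡ k′)
normal ≟ᵏ normal = yes refl
normal ≟ᵏ query = no λ ()
normal ≟ᵏ halt _ = no λ ()
query ≟ᵏ normal = no λ ()
query ≟ᵏ query = yes refl
query ≟ᵏ halt _ = no λ ()
halt _ ≟ᵏ normal = no λ ()
halt _ ≟ᵏ query = no λ ()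
halt acc ≟ᵏ halt acc = yes refl
halt acc ≟ᵏ halt rej = no λ ()
halt acc ≟ᵏ halt unk = no λ ()
halt rej ≟ᵏ halt acc = no λ ()
halt rej ≟ᵏ halt rej = yes refl
halt rej ≟ᵏ halt unk = no λ ()
halt unk ≟ᵏ halt acc = no λ ()
halt unk ≟ᵏ halt rej = no λ ()
halt unk ≟ᵏ halt unk = yes refl

module Paths (N : NOTM) where
  open NOTM N

  queries : ∀ {D k c c′} → Steps N D k c c′ → List Str
  queries done                          = []
  queries (step (move _ _) s)           = queries s
  queries (step (ask {qt = qt} _) s)    = readBits N (contents N qt) ∷ queries s

  length-queries : ∀ {D k c c′} (s : Steps N D k c c′) → length (queries s) ≤ k
  length-queries done                = z≤n
  length-queries (step (move _ _) s) = m≤n⇒m≤1+n (length-queries s)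
  length-queries (step (ask _) s)    = s≤s (length-queries s)

  -- A path sees the oracle only through its own queries. This moves paths into a hybrid oracle, and
  -- later from the limit oracle to the oracle of a single stage.
  transport : ∀ {D D′ k c c′} (s : Steps N D k c c′) →
              (∀ {q} → q ∈ queries s → D q ≡ D′ q) → Steps N D′ k c c′
  transport done h = done
  transport (step (move e m) s) h = step (move e m) (transport s h)
  transport {D′ = D′} (step (ask {w = w} {qt = qt} e) s) h =
    step (subst (λ b → Step N D′ _ (cfg (if b then qYes else qNo) w (emptyTape N)))
                (sym (h (here refl))) (ask e))
         (transport s (h ∘ there))

  size : Tape N → ℕ
  size (tape l _ r) = suc (length l + length r)

  length-contents : ∀ t → length (contents N t) ≡ size t
  length-contents (tape l c r) = begin
    length (reverse l ++ c ∷ r)        ≡⟨ length-++ (reverse l) ⟩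
    length (reverse l) + suc (length r) ≡⟨ cong (_+ suc (length r)) (length-reverse l) ⟩
    length l + suc (length r)          ≡⟨ +-suc (length l) (length r) ⟩
    suc (length l + length r)          ∎
    where open ≡-Reasoning

  size-writeMove : ∀ s m t → size (writeMove N s m t) ≤ suc (size t)
  size-writeMove s L (tape [] _ r)      = n≤1+n _
  size-writeMove s L (tape (a ∷ l) _ r) = ≤-trans (≤-reflexive (cong suc (+-suc (length l) (length r)))) (n≤1+n _)
  size-writeMove s R (tape l _ [])      = ≤-refl
  size-writeMove s R (tape l _ (a ∷ r)) =
    ≤-trans (≤-reflexive (cong suc (sym (+-suc (length l) (length r))))) (n≤1+n _)
  size-writeMove s S (tape l _ r)       = n≤1+n _

  length-readBits : ∀ l → length (readBits N l) ≤ length l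
  length-readBits [] = z≤n
  length-readBits (Fin.zero ∷ _) = z≤n
  length-readBits (Fin.suc Fin.zero ∷ l) = s≤s (length-readBits l)
  length-readBits (Fin.suc (Fin.suc Fin.zero) ∷ l) = s≤s (length-readBits l)
  length-readBits (Fin.suc (Fin.suc (Fin.suc _)) ∷ _) = z≤n

  -- A move lengthens the query tape by at most one cell, and an answered query resets it to one
  -- blank. From the initial tape this gives `1 + k`, which bounds the widths that a clocked machine
  -- can see.
  length-query : ∀ {D k c c′ q} (s : Steps N D k c c′) → q ∈ queries s →
                 length q ≤ size (Config.qtape c) + k
  length-query {k = suc k} {c = cfg _ _ qt} (step (move {t = _ , _ , _ , sq , mq} _ _) s) q∈ =
    ≤-trans (length-query s q∈)
      (≤-trans (+-monoˡ-≤ k (size-writeMove sq mq qt)) (≤-reflexive (sym (+-suc (size qt) k))))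
  length-query {c = cfg _ _ qt} (step (ask _) s) (here refl) =
    ≤-trans (length-readBits (contents N qt))
      (≤-trans (≤-reflexive (length-contents qt)) (m≤m+n _ _))
  length-query {k = suc k} {c = cfg _ _ qt} (step (ask _) s) (there q∈) =
    ≤-trans (length-query s q∈) (s≤s (≤-trans (n≤1+n k) (m≤n+m (suc k) _)))

  Reach : Lang → ℕ → Config N → Outcome → Set
  Reach D t c o = Σ ℕ λ k → k ≤ t × Σ (Config N) λ c′ →
                  Steps N D k c c′ × kind (Config.state c′) ≡ halt o

  reach-step : ∀ {D t c c′ o} → Step N D c c′ → Reach D t c′ o → Reach D (suc t) c o
  reach-step s (k , k≤t , c″ , ss , h) = suc k , s≤s k≤t , c″ , step s ss , h

  halted-no-step : ∀ {D c c′ o} → kind (Config.state c) ≡ halt o → ¬ Step N D c c′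
  halted-no-step h (move n _) with () ← trans (sym h) n
  halted-no-step h (ask q) with () ← trans (sym h) q

  -- The horizon is bounded and every choice list is finite. Each round of the adversary can
  -- therefore test whether `N` gives the right answer, and return the instance itself if it does
  -- not.
  reach? : ∀ D t c o → Dec (Reach D t c o)
  reach? D t c o with kind (Config.state c) ≟ᵏ halt o
  ... | yes h = yes (0 , z≤n , c , done , h)
  reach? D zero c o | no ¬h = no λ { (zero , _ , _ , done , h) → ¬h h }
  reach? D (suc t) c@(cfg q w qt) o | no ¬h with kind q in eq
  ... | halt _ = no λ { (zero , _ , _ , done , h) → ¬h (trans (sym eq) h)
                      ; (suc k , _ , _ , step s _ , _) → halted-no-step eq s }
  ... | query = map′ (reach-step (ask eq)) back (reach? D t _ o)
    where
    back : Reach D (suc t) c o → Reach D t (cfg (if D (readBits N (contents N qt)) then qYes else qNo) w (emptyTape N)) o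
    back (zero , _ , _ , done , h) with () ← trans (sym eq) h
    back (suc k , _ , _ , step (move n _) _ , _) with () ← trans (sym eq) n
    back (suc k , s≤s k≤t , c′ , step (ask _) s , h) = k , k≤t , c′ , s , h
  ... | normal = map′ forth back
                   (any? (λ u → reach? D t (apply N c u) o) (toList (δ q (Tape.cur w) (Tape.cur qt))))
    where
    forth : _ → Reach D (suc t) c o
    forth a with find a
    ... | u , u∈ , r = reach-step (move eq u∈) r
    back : Reach D (suc t) c o → _
    back (zero , _ , _ , done , h) with () ← trans (sym eq) h
    back (suc k , s≤s k≤t , c′ , step (move _ u∈) s , h) = lose u∈ (k , k≤t , c′ , s , h)
    back (suc k , _ , _ , step (ask q) _ , _) with () ← trans (sym eq) q

-- Path instances and the adversary

bit : Bool → ℕ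
bit true  = 1
bit false = 0

val : Str → ℕ
val []       = 0
val (b ∷ bs) = bit b + 2 * val bs

even : ℕ → Bool
even 0             = true
even 1             = false
even (suc (suc n)) = even n

even-suc : ∀ n → even (suc n) ≡ not (even n)
even-suc 0             = refl
even-suc 1             = refl
even-suc (suc (suc n)) = even-suc n

pairs : Str → List (Bool × Bool)
pairs (a ∷ b ∷ q) = (a , b) ∷ pairs q
pairs _           = []

width row col : Str → ℕ
width q = length (pairs q)
row q   = val (map proj₁ (pairs q))
col q   = val (map proj₂ (pairs q))

-- An increasing path 0 → f 0 → f (f 0) → … ending at e; f is 0 off the path, so that
-- by sink the only edge into a point without a successor is the one into e.
record Inst (n : ℕ) : Set where
  field
    f      : ℕ → ℕ
    e      : ℕ
    e<2^n  : e < 2 ^ n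
    f≤e    : ∀ y → f y ≤ e
    beyond : ∀ y → e ≤ y → f y ≡ 0
    source : f 0 ≡ 0 → e ≡ 0
    sink   : ∀ y → 0 < f y → f (f y) ≤ f y → f y ≡ e

open Inst

trivial : ∀ n → Inst n
trivial n = record
  { f      = λ _ → 0
  ; e      = 0
  ; e<2^n  = m^n>0 2 n
  ; f≤e    = λ _ → z≤n
  ; beyond = λ _ _ → refl
  ; source = λ _ → refl
  ; sink   = λ _ ()
  }

module _ {n} (F : Inst n) {e′ : ℕ} (e<e′ : e F < e′) (e′<2^n : e′ < 2 ^ n) where

  redirect : ℕ → ℕ
  redirect y with y ≟ e F
  ... | yes _ = e′
  ... | no _  = f F y

  redirect-≢ : ∀ {y} → y ≢ e F → redirect y ≡ f F y
  redirect-≢ {y} y≢ with y ≟ e F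
  ... | yes y≡ = contradiction y≡ y≢
  ... | no _   = refl

  -- Only the row `e F` changes, so whoever has not asked about it cannot notice. No false sink
  -- arises: a value `f F y` other than `e F` is settled by the old `sink`, and the old end now has
  -- the larger successor `e′`.
  extend : Inst n
  extend = record
    { f = redirect ; e = e′ ; e<2^n = e′<2^n
    ; f≤e = bound ; beyond = beyond′ ; source = source′ ; sink = sink′ }
    where
    bound : ∀ y → redirect y ≤ e′
    bound y with y ≟ e F
    ... | yes refl = ≤-refl
    ... | no _     = ≤-trans (f≤e F y) (<⇒≤ e<e′)

    beyond′ : ∀ y → e′ ≤ y → redirect y ≡ 0
    beyond′ y e′≤y = trans (redirect-≢ (>⇒≢ (<-≤-trans e<e′ e′≤y)))
                           (beyond F y (<⇒≤ (<-≤-trans e<e′ e′≤y)))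

    source′ : redirect 0 ≡ 0 → e′ ≡ 0
    source′ with 0 ≟ e F
    ... | yes _  = λ e′≡0 → e′≡0
    ... | no 0≢e = λ f0≡0 → contradiction (sym (source F f0≡0)) 0≢e

    sink′ : ∀ y → 0 < redirect y → redirect (redirect y) ≤ redirect y → redirect y ≡ e′
    sink′ y with y ≟ e F
    ... | yes refl = λ _ _ → refl
    ... | no y≢e   = absurd
      where
      absurd : 0 < f F y → redirect (f F y) ≤ f F y → f F y ≡ e′
      absurd 0<fy le with f F y ≟ e F
      ... | no fy≢e = contradiction (sink F y 0<fy le) fy≢e
      ... | yes fy≡e = contradiction (≤-trans le (≤-reflexive fy≡e)) (<⇒≱ e<e′)

Family : Set
Family = ∀ n → Inst n

-- The query interleaving y and w is answered by whether f y ≤ w, so that two answers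
-- at w and w + 1 certify f y = w + 1.
oracle : Family → Lang
oracle I q = f (I (width q)) (row q) ≤ᵇ col q

update : Family → ∀ n → Inst n → Family
update I n F m with n ≟ m
... | yes refl = F
... | no _     = I m

oracle-update : ∀ I n (F G : Inst n) q → f F (row q) ≡ f G (row q) →
                oracle (update I n F) q ≡ oracle (update I n G) q
oracle-update I n F G q eq with n ≟ width q
... | yes refl = cong (_≤ᵇ col q) eq
... | no _     = refl

-- Pigeonhole: if the first `suc (length V)` values all lay in `V`, two of them would share a
-- position there.
fresh-index : ∀ (V : List ℕ) (c : ℕ → ℕ) → (∀ {i j} → c i ≡ c j → i ≡ j) →
              ∃ λ i → i ≤ length V × c i ∉ V
fresh-index V c c-inj 
  with ¬∀⟶∃¬ (suc (length V)) (λ i → c (toℕ i) ∈ V) (λ i → c (toℕ i) ∈? V) not-all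
  where
  not-all : ¬ (∀ i → c (toℕ i) ∈ V)
  not-all all with pigeonhole (n<1+n (length V)) (λ i → index (all i))
  ... | i , j , i<j , eq = <⇒≢ i<j (toℕ-injective (c-inj
          (trans (lookup-index (all i)) (trans (cong (lookup V) eq) (sym (lookup-index (all j)))))))
... | i , c∉V = toℕ i , toℕ≤pred[n] i , c∉V

next-of-parity : ∀ e b → ∃ λ e′ → e < e′ × e′ ≤ 2 + e × even e′ ≡ b
next-of-parity e b with Data.Bool._≟_ (even e) b
... | yes eq = suc (suc e) , n≤1+n _ , ≤-refl , eq
... | no neq = suc e , ≤-refl , n≤1+n _ , trans (even-suc e) (sym (¬-not (neq ∘ sym)))

-- At most two steps fix the parity, and at most `length V` further steps of size two get past the
-- members of `V`.
fresh : ∀ (V : List ℕ) e b → ∃ λ e′ → e < e′ × e′ ≤ e + (2 * length V + 2) × e′ ∉ V × even e′ ≡ b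
fresh V e b with next-of-parity e b
... | e₀ , e<e₀ , e₀≤ , par 
  with fresh-index V (λ i → i * 2 + e₀)
         (λ {i} {j} eq → *-cancelʳ-≡ i j 2 (+-cancelʳ-≡ e₀ (i * 2) (j * 2) eq))
... | i , i≤ , c∉V = i * 2 + e₀ , ≤-trans e<e₀ (m≤n+m e₀ (i * 2)) , bound , c∉V , trans (even-shift i) par
  where
  even-shift : ∀ i → even (i * 2 + e₀) ≡ even e₀
  even-shift zero    = refl
  even-shift (suc i) = even-shift i
  bound : i * 2 + e₀ ≤ e + (2 * length V + 2)
  bound = begin
    i * 2 + e₀                ≤⟨ +-mono-≤ (*-monoˡ-≤ 2 i≤) e₀≤ ⟩
    length V * 2 + (2 + e)    ≡⟨ cong₂ _+_ (*-comm (length V) 2) refl ⟩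
    2 * length V + (2 + e)    ≡⟨ sym (+-assoc (2 * length V) 2 e) ⟩
    2 * length V + 2 + e      ≡⟨ +-comm _ e ⟩
    e + (2 * length V + 2)    ∎
    where open ≤-Reasoning

outside : List ℕ → List ℕ → List ℕ
outside V = filter (λ y → ¬? (y ∈? V))

outside-mono : ∀ {V V′} → (∀ {y} → y ∈ V → y ∈ V′) → ∀ ys →
               length (outside V′ ys) ≤ length (outside V ys)
outside-mono V⊆V′ [] = z≤n
outside-mono {V} {V′} V⊆V′ (y ∷ ys) with y ∈? V′ | y ∈? V
... | yes _  | yes _  = outside-mono V⊆V′ ys
... | yes _  | no _   = m≤n⇒m≤1+n (outside-mono V⊆V′ ys)
... | no ∉V′ | yes ∈V = contradiction (V⊆V′ ∈V) ∉V′
... | no _   | no _   = s≤s (outside-mono V⊆V′ ys)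

-- Enlarging `V` adds no entry to the count and removes at least one. Repetitions in `ys` count,
-- which is harmless: the final comparison is with the number of queries, which counts them as well.
outside-strict : ∀ {V V′} → (∀ {y} → y ∈ V → y ∈ V′) → ∀ {ys} →
                 Any (λ y → y ∈ V′ × y ∉ V) ys →
                 length (outside V′ ys) < length (outside V ys)
outside-strict {V} {V′} V⊆V′ {y ∷ ys} (here (∈V′ , ∉V)) with y ∈? V′ | y ∈? V
... | no ∉V′ | _      = contradiction ∈V′ ∉V′
... | yes _  | yes ∈V = contradiction ∈V ∉V
... | yes _  | no _   = s≤s (outside-mono V⊆V′ ys)
outside-strict {V} {V′} V⊆V′ {y ∷ ys} (there a) with y ∈? V′ | y ∈? V
... | yes _  | yes _  = outside-strict V⊆V′ a
... | yes _  | no _   = m≤n⇒m≤1+n (outside-strict V⊆V′ a)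
... | no ∉V′ | yes ∈V = contradiction (V⊆V′ ∈V) ∉V′
... | no _   | no _   = s≤s (outside-strict V⊆V′ a)

answer : Bool → Outcome
answer b = if b then acc else rej

module Adversary (N : NOTM) (x : Str) (n t : ℕ) (I : Family) where
  open NOTM N
  open Paths N

  D : Inst n → Lang
  D F = oracle (update I n F)

  Correct : Inst n → Set
  Correct F = Reach (D F) t (initCfg N x) (answer (even (e F)))

  Fooled : Set
  Fooled = (Σ (Inst n) λ F → ¬ Correct F) ⊎ ¬ RobustlyUnderproductive N

  Agree : List ℕ → Inst n → Inst n → Set
  Agree V F G = ∀ y → y ∈ V → f F y ≡ f G y

  rows : ∀ {D k c c′} → Steps N D k c c′ → List ℕ
  rows s = map row (queries s)

  length-rows : ∀ {D k c c′} (s : Steps N D k c c′) → length (rows s) ≤ k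
  length-rows s = ≤-trans (≤-reflexive (length-map row (queries s))) (length-queries s)

  -- If the two paths shared no newly revealed row, both would survive in a single oracle.
  conflict : ∀ (F G : Inst n) {k l c d} (V : List ℕ)
             (s : Steps N (D F) k (initCfg N x) c) (r : Steps N (D G) l (initCfg N x) d) →
             kind (Config.state c) ≡ halt acc → kind (Config.state d) ≡ halt rej →
             Agree V F G →
             Any (λ y → y ∈ rows s ++ V × y ∉ V) (rows r) ⊎ ¬ RobustlyUnderproductive N
  conflict F G V s r hs hr agree = shared (any? (λ y → (y ∈? (rows s ++ V)) ×-dec ¬? (y ∈? V)) (rows r))
    where
    -- The choice depends on the row alone, so all thresholds of a row are answered by the same
    -- side. The result need not come from any instance.
    hybrid : Lang
    hybrid q with row q ∈? rows s
    ... | yes _ = D F q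
    ... | no _  = D G q

    on-s : ∀ {q} → q ∈ queries s → D F q ≡ hybrid q
    on-s {q} q∈ with row q ∈? rows s
    ... | yes _ = refl
    ... | no ∉s = contradiction (∈-map⁺ row q∈) ∉s

    on-r : ¬ Any (λ y → y ∈ rows s ++ V × y ∉ V) (rows r) →
           ∀ {q} → q ∈ queries r → D G q ≡ hybrid q
    on-r ¬a {q} q∈ with row q ∈? rows s
    ... | no _   = refl
    -- A row asked by both paths lies in `V` when nothing new is shared, and there `F` and `G`
    -- agree.
    ... | yes ∈s = oracle-update I n G F q (sym (agree (row q) (decidable-stable (row q ∈? V)
                     (λ ∉V → ¬a (lose (∈-map⁺ row q∈) (∈-++⁺ˡ ∈s , ∉V))))))

    shared : Dec (Any (λ y → y ∈ rows s ++ V × y ∉ V) (rows r)) → _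
    shared (yes a) = inj₁ a
    shared (no ¬a) = inj₂ λ under →
      under hybrid x ((_ , _ , transport s on-s , hs) , (_ , _ , transport r (on-r ¬a) , hr))

  -- Each round of the adversary raises k by one; k > t is absurd on a path of length t.
  RejPath : ℕ → Inst n → List ℕ → Set
  RejPath k F V = Σ (Inst n) λ G → Agree V F G ×
    Σ ℕ λ j → j ≤ t × Σ (Config N) λ c → Σ (Steps N (D G) j (initCfg N x) c) λ s →
    kind (Config.state c) ≡ halt rej × k ≤ length (outside V (rows s))

  extend-agrees : ∀ (F : Inst n) {e′} (lt : e F < e′) (b : e′ < 2 ^ n) {V} → e F ∉ V →
                  Agree V F (extend F lt b)
  extend-agrees F lt b e∉V y y∈V = sym (redirect-≢ F lt b λ { refl → e∉V y∈V })

  -- M bounds the number of revealed rows.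
  module _ (M : ℕ) where

    room : ∀ k (V : List ℕ) e {e′} → length V ≤ M → e + suc k * (2 * M + 2) < 2 ^ n →
           e′ ≤ e + (2 * length V + 2) → e′ + k * (2 * M + 2) < 2 ^ n
    room k V e {e′} V≤M fits e′≤ = ≤-<-trans (begin
      e′ + k * (2 * M + 2)                        ≤⟨ +-monoˡ-≤ _ e′≤ ⟩
      e + (2 * length V + 2) + k * (2 * M + 2)    ≤⟨ +-monoˡ-≤ _ (+-monoʳ-≤ e (+-monoˡ-≤ 2 (*-monoʳ-≤ 2 V≤M))) ⟩
      e + (2 * M + 2) + k * (2 * M + 2)           ≡⟨ +-assoc e _ _ ⟩
      e + suc k * (2 * M + 2)                     ∎) fits
      where open ≤-Reasoning

    -- `V` holds the revealed rows; as `e F` is not among them, the end can still be moved. Each of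
    -- the `k` remaining rounds reveals at most `t` rows, whence the bound by `M`. Each round, and
    -- the base case once more, moves the end by at most `2 * M + 2`, whence the factor `suc k`.
    adversary : ∀ k (F : Inst n) V → e F ∉ V → length V + k * t ≤ M →
                e F + suc k * (2 * M + 2) < 2 ^ n → Fooled ⊎ RejPath k F V
    -- An odd end forces a correct machine to reject; this supplies the rejecting path that the
    -- rounds then work on.
    adversary zero F V e∉V V≤M fits = try (fresh V (e F) false)
      where
      try : (∃ λ e′ → e F < e′ × e′ ≤ e F + (2 * length V + 2) × e′ ∉ V × even e′ ≡ false) →
            Fooled ⊎ RejPath zero F V
      try (e′ , lt , e′≤ , _ , odd) = result (reach? (D G) t (initCfg N x) rej)
        where
        b : e′ < 2 ^ n
        b = ≤-<-trans (m≤m+n e′ 0) (room 0 V (e F) (m+n≤o⇒m≤o (length V) V≤M) fits e′≤)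
        G : Inst n
        G = extend F lt b
        result : Dec (Reach (D G) t (initCfg N x) rej) → Fooled ⊎ RejPath zero F V
        result (no ¬r) = inj₁ (inj₁ (G , ¬r ∘ subst (Reach (D G) t (initCfg N x)) (cong answer odd)))
        result (yes (j , j≤ , c , s , h)) =
          inj₂ (G , extend-agrees F lt b e∉V , j , j≤ , c , s , h , z≤n)
    adversary (suc k) F V e∉V V≤M fits = try (fresh V (e F) true)
      where
      try : (∃ λ e₁ → e F < e₁ × e₁ ≤ e F + (2 * length V + 2) × e₁ ∉ V × even e₁ ≡ true) →
            Fooled ⊎ RejPath (suc k) F V
      try (e₁ , lt₁ , e₁≤ , _ , ev) = result (reach? (D G) t (initCfg N x) acc)
        where
        b₁ : e₁ < 2 ^ n
        b₁ = ≤-<-trans (m≤m+n e₁ _) (room (suc k) V (e F) (m+n≤o⇒m≤o (length V) V≤M) fits e₁≤)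
        G : Inst n
        G = extend F lt₁ b₁
        result : Dec (Reach (D G) t (initCfg N x) acc) → Fooled ⊎ RejPath (suc k) F V
        result (no ¬r) = inj₁ (inj₁ (G , ¬r ∘ subst (Reach (D G) t (initCfg N x)) (cong answer ev)))
        -- The path `s` may have asked about `e₁`, the end of `G`, so `G` cannot be continued.
        -- Instead the end of `F` is moved a second time, to a point outside everything that `s`
        -- saw.
        result (yes (j , j≤ , c , s , h)) = retry (fresh V′ (e F) true)
          where
          V′ : List ℕ
          V′ = rows s ++ V
          V′≤M : length V′ + k * t ≤ M
          V′≤M = begin
            length V′ + k * t                        ≡⟨ cong (_+ k * t) (length-++ (rows s)) ⟩
            length (rows s) + length V + k * t       ≤⟨ +-monoˡ-≤ (k * t) (+-monoˡ-≤ (length V) (≤-trans (length-rows s) j≤)) ⟩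
            t + length V + k * t                     ≡⟨ cong (_+ k * t) (+-comm t (length V)) ⟩
            length V + t + k * t                     ≡⟨ +-assoc (length V) t (k * t) ⟩
            length V + suc k * t                     ≤⟨ V≤M ⟩
            M                                        ∎
            where open ≤-Reasoning
          retry : (∃ λ e₂ → e F < e₂ × e₂ ≤ e F + (2 * length V′ + 2) × e₂ ∉ V′ × even e₂ ≡ true) →
                  Fooled ⊎ RejPath (suc k) F V
          retry (e₂ , lt₂ , e₂≤ , e₂∉ , _) = combine (adversary k F′ V′ e₂∉ V′≤M fits′)
            where
            fits′ : e₂ + suc k * (2 * M + 2) < 2 ^ n
            fits′ = room (suc k) V′ (e F) (m+n≤o⇒m≤o (length V′) V′≤M) fits e₂≤
            b₂ : e₂ < 2 ^ n
            b₂ = ≤-<-trans (m≤m+n e₂ _) fits′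
            F′ : Inst n
            F′ = extend F lt₂ b₂
            combine : Fooled ⊎ RejPath k F′ V′ → Fooled ⊎ RejPath (suc k) F V
            combine (inj₁ fooled) = inj₁ fooled
            -- `G` and `H` both agree with `F` on `V`, so `conflict` applies. It yields a row of `r`
            -- in `V′` but not in `V`; the recursive count looked only outside `V′`, so this row is
            -- an additional one.
            combine (inj₂ (H , F′~H , j′ , j′≤ , c′ , r , h′ , k≤)) = decide (conflict G H V s r h h′ G~H)
              where
              F~H : Agree V F H
              F~H y y∈V = trans (extend-agrees F lt₂ b₂ e∉V y y∈V) (F′~H y (∈-++⁺ʳ (rows s) y∈V))
              G~H : Agree V G H
              G~H y y∈V = trans (sym (extend-agrees F lt₁ b₁ e∉V y y∈V)) (F~H y y∈V)
              decide : Any (λ y → y ∈ V′ × y ∉ V) (rows r) ⊎ ¬ RobustlyUnderproductive N →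
                       Fooled ⊎ RejPath (suc k) F V
              decide (inj₂ ¬under) = inj₁ (inj₂ ¬under)
              decide (inj₁ a) = inj₂ (H , F~H , j′ , j′≤ , c′ , r , h′ ,
                                      ≤-<-trans k≤ (outside-strict (∈-++⁺ʳ (rows s)) a))

  abstract
    fool : (2 + t) * (2 * (suc t * t) + 2) < 2 ^ n → Fooled
    -- `suc t` rounds reveal at most `suc t * t` rows. They start from the empty path, whose end is
    -- `0`, with nothing revealed; the resulting `suc t` queries exceed the length of the path.
    fool fits = conclude (adversary (suc t * t) (suc t) (trivial n) [] (λ ()) ≤-refl fits)
      where
      conclude : Fooled ⊎ RejPath (suc t) (trivial n) [] → Fooled
      conclude (inj₁ fooled) = fooled
      conclude (inj₂ (_ , _ , j , j≤ , _ , s , _ , t<)) = contradiction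
        (≤-trans t< (≤-trans (length-filter _ (rows s)) (≤-trans (length-rows s) j≤))) 1+n≰n

-- Enumeration of machines

-- Walks along the antidiagonals of ℕ × ℕ.
unpair : ℕ → ℕ × ℕ
unpair zero    = 0 , 0
unpair (suc n) with unpair n
... | a , zero  = 0 , suc a
... | a , suc b = suc a , b

unpair-suc : ∀ n {a b} → unpair n ≡ (a , suc b) → unpair (suc n) ≡ (suc a , b)
unpair-suc n eq rewrite eq = refl

unpair-turn : ∀ n {a} → unpair n ≡ (a , 0) → unpair (suc n) ≡ (0 , suc a)
unpair-turn n eq rewrite eq = refl

-- Each antidiagonal starts at `(0 , s)` and is entered from `(s - 1 , 0)`, the last point of the
-- previous one.
unpair-along : ∀ s a b → a + b ≡ s → ∃ λ n → unpair n ≡ (a , b)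
unpair-along zero    zero    zero    refl = 0 , refl
unpair-along (suc s) zero    (suc .s) refl with unpair-along s s 0 (+-identityʳ s)
... | n , eq = suc n , unpair-turn n eq
unpair-along s (suc a) b eq with unpair-along s a (suc b) (trans (+-suc a b) eq)
... | n , eq′ = suc n , unpair-suc n eq′

unpair-surjective : ∀ p → ∃ λ n → unpair n ≡ p
unpair-surjective (a , b) = unpair-along (a + b) a b refl

-- A relation replaces equality because function tables can be reached only up to pointwise
-- equality.
Covers : {X Y : Set} (Rel : X → Y → Set) → (ℕ → X) → Set
Covers Rel e = ∀ y → ∃ λ i → Rel (e i) y

Enumerates : {X : Set} → (ℕ → X) → Set
Enumerates = Covers _≡_

-- Repeated unpairing reads a number as an infinite sequence, and every finite sequence is a prefix
-- of one of these.
seq : ℕ → ℕ → ℕ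
seq c zero    = proj₁ (unpair c)
seq c (suc i) = seq (proj₂ (unpair c)) i

table : {X : Set} {n : ℕ} → (ℕ → X) → ℕ → Fin n → X
table e c i = e (seq c (toℕ i))

Pointwise : {X Y : Set} (Rel : X → Y → Set) {n : ℕ} → (Fin n → X) → (Fin n → Y) → Set
Pointwise Rel g f = ∀ i → Rel (g i) (f i)

table-covers : {X Y : Set} (Rel : X → Y → Set) {e : ℕ → X} → Covers Rel e →
               ∀ {n} → Covers (Pointwise Rel {n}) (table e)
table-covers Rel {e} cov {zero}  f = 0 , λ ()
table-covers Rel {e} cov {suc n} f with cov (f zero) | table-covers Rel cov (λ i → f (suc i))
... | i , r | c , rs with unpair-surjective (i , c)
... | d , eq = d , entries
  where
  entries : Pointwise Rel (table e d) f
  entries zero    = subst (λ p → Rel (e (proj₁ p)) (f zero)) (sym eq) r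
  entries (suc j) = subst (λ p → Rel (e (seq (proj₂ p) (toℕ j))) (f (suc j))) (sym eq) (rs j)

pair : {X Y : Set} → (ℕ → X) → (ℕ → Y) → ℕ → X × Y
pair e e′ c = e (proj₁ (unpair c)) , e′ (proj₂ (unpair c))

pair-enumerates : {X Y : Set} {e : ℕ → X} {e′ : ℕ → Y} →
                  Enumerates e → Enumerates e′ → Enumerates (pair e e′)
pair-enumerates {e = e} {e′} en en′ (x , y) with en x | en′ y
... | i , refl | j , refl with unpair-surjective (i , j)
... | c , eq = c , cong (λ p → e (proj₁ p) , e′ (proj₂ p)) eq

fin : ∀ n → ℕ → Fin (suc n)
fin n i = i mod suc n

fin-enumerates : ∀ n → Enumerates (fin n)
fin-enumerates n i = toℕ i , toℕ-injective (trans (toℕ-fromℕ< _) (m<n⇒m%n≡m (toℕ<n i)))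

aMove : ℕ → Move
aMove 0 = L
aMove 1 = R
aMove _ = S

aMove-enumerates : Enumerates aMove
aMove-enumerates L = 0 , refl
aMove-enumerates R = 1 , refl
aMove-enumerates S = 2 , refl

aKind : ℕ → Kind
aKind 0 = normal
aKind 1 = query
aKind 2 = halt acc
aKind 3 = halt rej
aKind _ = halt unk

aKind-enumerates : Enumerates aKind
aKind-enumerates normal     = 0 , refl
aKind-enumerates query      = 1 , refl
aKind-enumerates (halt acc) = 2 , refl
aKind-enumerates (halt rej) = 3 , refl
aKind-enumerates (halt unk) = 4 , refl

list⁺ : {X : Set} → (ℕ → X) → ℕ → List⁺ X
list⁺ e c = e (seq c 0) ∷ tabulate {n = seq c 1} (λ i → e (seq c (2 + toℕ i)))

list⁺-enumerates : {X : Set} {e : ℕ → X} → Enumerates e → Enumerates (list⁺ e)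
list⁺-enumerates {e = e} en (x ∷ xs)
  with en x | table-covers _≡_ {e} en (lookup xs)
... | i , refl | c , eq with unpair-surjective (length xs , c)
... | d , eq′ with unpair-surjective (i , d)
... | b , eq″ = b , trans (cong decode eq″) (cong (e i ∷_) (trans (cong decodeTail eq′)
                  (trans (tabulate-cong eq) (tabulate-lookup xs))))
  where
  decodeTail : ℕ × ℕ → List _
  decodeTail p = tabulate {n = proj₁ p} (λ j → e (seq (proj₂ p) (toℕ j)))
  decode : ℕ × ℕ → List⁺ _
  decode p = e (proj₁ p) ∷ decodeTail (unpair (proj₂ p))

Transition : ℕ → ℕ → Set
Transition n m = Fin (suc n) × Fin (3 + m) × Move × Fin (3 + m) × Move

infix 4 _≈_
-- Without function extensionality, machines with pointwise equal tables are not provably equal.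
-- `≈-path` shows that computation paths cannot tell them apart.
data _≈_ : NOTM → NOTM → Set where
  tables : ∀ {nSt m start qYes qNo kind kind′ δ δ′} →
           (∀ q → kind q ≡ kind′ q) → (∀ q a b → δ q a b ≡ δ′ q a b) →
           record { nSt = nSt ; m = m ; start = start ; qYes = qYes ; qNo = qNo ; kind = kind ; δ = δ } ≈
           record { nSt = nSt ; m = m ; start = start ; qYes = qYes ; qNo = qNo ; kind = kind′ ; δ = δ′ }

tables-≡ : ∀ {nSt m start start′ qYes qYes′ qNo qNo′ kind kind′ δ δ′} →
           start ≡ start′ → qYes ≡ qYes′ → qNo ≡ qNo′ →
           (∀ q → kind q ≡ kind′ q) → (∀ q a b → δ q a b ≡ δ′ q a b) →
           record { nSt = nSt ; m = m ; start = start ; qYes = qYes ; qNo = qNo ; kind = kind ; δ = δ } ≈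
           record { nSt = nSt ; m = m ; start = start′ ; qYes = qYes′ ; qNo = qNo′ ; kind = kind′ ; δ = δ′ }
tables-≡ refl refl refl = tables

≈-sym : ∀ {N N′} → N ≈ N′ → N′ ≈ N
≈-sym (tables k d) = tables (λ q → sym (k q)) (λ q a b → sym (d q a b))

module _ {nSt m : ℕ} {start qYes qNo : Fin (suc nSt)} {kind kind′ : Fin (suc nSt) → Kind}
         {δ δ′ : Fin (suc nSt) → Fin (3 + m) → Fin (3 + m) → List⁺ (Transition nSt m)}
         (kind-≡ : ∀ q → kind q ≡ kind′ q) (δ-≡ : ∀ q a b → δ q a b ≡ δ′ q a b) where

  private
    N N′ : NOTM
    N  = record { nSt = nSt ; m = m ; start = start ; qYes = qYes ; qNo = qNo ; kind = kind ; δ = δ }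
    N′ = record { nSt = nSt ; m = m ; start = start ; qYes = qYes ; qNo = qNo ; kind = kind′ ; δ = δ′ }

  -- Tapes and configurations are types indexed by the machine, so they must be converted even
  -- though the alphabets coincide.
  convTape : Tape N → Tape N′
  convTape (tape l c r) = tape l c r

  conv : Config N → Config N′
  conv (cfg q w qt) = cfg q (convTape w) (convTape qt)

  convTape-writeMove : ∀ a d t → convTape (writeMove N a d t) ≡ writeMove N′ a d (convTape t)
  convTape-writeMove a L (tape [] _ _)      = refl
  convTape-writeMove a L (tape (_ ∷ _) _ _) = refl
  convTape-writeMove a R (tape _ _ [])      = refl
  convTape-writeMove a R (tape _ _ (_ ∷ _)) = refl
  convTape-writeMove a S (tape _ _ _)       = refl

  readBits-≡ : ∀ l → readBits N l ≡ readBits N′ l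
  readBits-≡ []                       = refl
  readBits-≡ (zero ∷ _)               = refl
  readBits-≡ (suc zero ∷ l)           = cong (false ∷_) (readBits-≡ l)
  readBits-≡ (suc (suc zero) ∷ l)     = cong (true ∷_) (readBits-≡ l)
  readBits-≡ (suc (suc (suc _)) ∷ _)  = refl

  bitSym-≡ : ∀ b → bitSym N b ≡ bitSym N′ b
  bitSym-≡ false = refl
  bitSym-≡ true  = refl

  conv-init : ∀ x → conv (initCfg N x) ≡ initCfg N′ x
  conv-init []      = refl
  conv-init (b ∷ x) = cong₂ (λ a as → cfg start (tape [] a as) (emptyTape N′))
                            (bitSym-≡ b) (map-cong bitSym-≡ x)

  conv-step : ∀ {D c c′} → Step N D c c′ → Step N′ D (conv c) (conv c′)
  conv-step {D} (move {q} {w} {qt} {t = t@(_ , sw , mw , sq , mq)} k t∈) =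
    subst (Step N′ D (conv (cfg q w qt)))
          (cong₂ (cfg _) (sym (convTape-writeMove sw mw w)) (sym (convTape-writeMove sq mq qt)))
          (move (trans (sym (kind-≡ q)) k)
                (subst (λ l → t ∈ toList l) (δ-≡ q _ _) t∈))
  conv-step {D} (ask {q} {w} {qt} k) =
    subst (λ s → Step N′ D (conv (cfg q w qt)) (cfg (if D s then qYes else qNo) (convTape w) (emptyTape N′)))
          (sym (readBits-≡ (contents N qt)))
          (ask (trans (sym (kind-≡ q)) k))

  conv-steps : ∀ {D k c c′} → Steps N D k c c′ → Steps N′ D k (conv c) (conv c′)
  conv-steps done       = done
  conv-steps (step s r) = step (conv-step s) (conv-steps r)

  conv-path : ∀ {D k x c o} → Steps N D k (initCfg N x) c → kind (Config.state c) ≡ halt o →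
              Σ (Config N′) λ c′ → Steps N′ D k (initCfg N′ x) c′ × kind′ (Config.state c′) ≡ halt o
  conv-path {D} {k} {x} {c@(cfg q _ _)} s h =
    conv c , subst (λ i → Steps N′ D k i (conv c)) (conv-init x) (conv-steps s) , trans (sym (kind-≡ q)) h

≈-path : ∀ {N N′ D k x c o} → N ≈ N′ → Steps N D k (initCfg N x) c → NOTM.kind N (Config.state c) ≡ halt o →
         Σ (Config N′) λ c′ → Steps N′ D k (initCfg N′ x) c′ × NOTM.kind N′ (Config.state c′) ≡ halt o
≈-path (tables k d) = conv-path k d

≈-Out : ∀ {N N′ D x o} → N ≈ N′ → Out N D x o → Out N′ D x o
≈-Out N≈ (k , c , s , h) with ≈-path N≈ s h
... | c′ , s′ , h′ = k , c′ , s′ , h′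

aTransition : ∀ n m → ℕ → Transition n m
aTransition n m = pair (fin n) (pair (fin (2 + m)) (pair aMove (pair (fin (2 + m)) aMove)))

aTransition-enumerates : ∀ n m → Enumerates (aTransition n m)
aTransition-enumerates n m =
  pair-enumerates (fin-enumerates n) (pair-enumerates (fin-enumerates (2 + m))
    (pair-enumerates aMove-enumerates (pair-enumerates (fin-enumerates (2 + m)) aMove-enumerates)))

assemble : ℕ × ℕ × ℕ × ℕ × ℕ × ℕ × ℕ → NOTM
assemble (n , m , start , qYes , qNo , kind , δ) = record
  { nSt   = n
  ; m     = m
  ; start = fin n start
  ; qYes  = fin n qYes
  ; qNo   = fin n qNo
  ; kind  = table aKind kind
  ; δ     = table (table (table (list⁺ (aTransition n m)))) δ
  }

codes : ℕ → ℕ × ℕ × ℕ × ℕ × ℕ × ℕ × ℕ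
codes = pair id (pair id (pair id (pair id (pair id (pair id id)))))

id-enumerates : Enumerates id
id-enumerates n = n , refl

codes-enumerates : Enumerates codes
codes-enumerates = pair-enumerates id-enumerates (pair-enumerates id-enumerates
  (pair-enumerates id-enumerates (pair-enumerates id-enumerates
  (pair-enumerates id-enumerates (pair-enumerates id-enumerates id-enumerates)))))

machine-covers : Covers _≈_ (assemble ∘ codes)
machine-covers N = cover (fin-enumerates nSt start) (fin-enumerates nSt qYes) (fin-enumerates nSt qNo)
                         (table-covers _≡_ aKind-enumerates kind)
                         (table-covers (Pointwise (Pointwise _≡_)) (table-covers (Pointwise _≡_)
                           (table-covers _≡_ (list⁺-enumerates (aTransition-enumerates nSt m)))) δ)
  where
  open NOTM N
  cover : (∃ λ i → fin nSt i ≡ start) → (∃ λ i → fin nSt i ≡ qYes) → (∃ λ i → fin nSt i ≡ qNo) →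
          (∃ λ i → Pointwise _≡_ (table aKind i) kind) →
          (∃ λ i → Pointwise (Pointwise (Pointwise _≡_))
                     (table (table (table (list⁺ (aTransition nSt m)))) i) δ) →
          ∃ λ c → assemble (codes c) ≈ N
  cover (a , a≡) (b , b≡) (d , d≡) (k , k≡) (t , t≡) = decode (codes-enumerates (nSt , m , a , b , d , k , t))
    where
    assembled : assemble (nSt , m , a , b , d , k , t) ≈ N
    assembled = tables-≡ a≡ b≡ d≡ k≡ t≡
    decode : (∃ λ c → codes c ≡ (nSt , m , a , b , d , k , t)) → ∃ λ c → assemble (codes c) ≈ N
    decode (c , eq) = c , subst (λ p → assemble p ≈ N) (sym eq) assembled

-- Diagonalisation

n<2^n : ∀ n → n < 2 ^ n
n<2^n zero    = s≤s z≤n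
n<2^n (suc n) = begin-strict
  suc n            ≡⟨ +-comm 1 n ⟩
  n + 1            <⟨ +-mono-<-≤ (n<2^n n) (m^n>0 2 n) ⟩
  2 ^ n + 2 ^ n    ≡⟨ cong (2 ^ n +_) (sym (+-identityʳ (2 ^ n))) ⟩
  2 ^ suc n        ∎
  where open ≤-Reasoning

-- The bound of `IsNPTM` at input length `suc n`, the length of `word n`.
clock : ℕ → ℕ → ℕ → ℕ
clock c d n = c * suc n ^ d + c

2^-double : ∀ a → 2 ^ a + 2 ^ a ≡ 2 ^ suc a
2^-double a = cong (2 ^ a +_) (sym (+-identityʳ (2 ^ a)))

cube-bound : ∀ t a → 2 + t ≤ 2 ^ a → (2 + t) * (2 * (suc t * t) + 2) ≤ 2 ^ (suc (a + a + a))
cube-bound t a t≤ = begin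
  (2 + t) * (2 * (suc t * t) + 2)          ≡⟨ cong ((2 + t) *_) (sym (*-distribˡ-+ 2 (suc t * t) 1)) ⟩
  (2 + t) * (2 * (suc t * t + 1))          ≤⟨ *-mono-≤ t≤ (*-monoʳ-≤ 2 square) ⟩
  2 ^ a * (2 * (2 ^ a * 2 ^ a))            ≡⟨ cong (λ z → 2 ^ a * (2 * z)) (sym (^-distribˡ-+-* 2 a a)) ⟩
  2 ^ a * (2 ^ suc (a + a))                ≡⟨ sym (^-distribˡ-+-* 2 a (suc (a + a))) ⟩
  2 ^ (a + suc (a + a))                    ≡⟨ cong (2 ^_) (trans (+-suc a (a + a)) (cong suc (sym (+-assoc a a a)))) ⟩
  2 ^ (suc (a + a + a))                    ∎
  where
  open ≤-Reasoning
  square : suc t * t + 1 ≤ 2 ^ a * 2 ^ a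
  square = begin
    suc t * t + 1       ≤⟨ +-monoʳ-≤ (suc t * t) (s≤s z≤n) ⟩
    suc t * t + suc t   ≡⟨ +-comm (suc t * t) (suc t) ⟩
    suc t + suc t * t   ≡⟨ sym (*-suc (suc t) t) ⟩
    suc t * suc t       ≤⟨ *-mono-≤ (≤-trans (n≤1+n _) t≤) (≤-trans (n≤1+n _) t≤) ⟩
    2 ^ a * 2 ^ a       ∎

clock-bound : ∀ c d k n → suc n ≡ 2 ^ k → 2 + clock c d n ≤ 2 ^ (2 + (c + k * d))
clock-bound c d k n eq = begin
  2 + (c * suc n ^ d + c)                ≡⟨ cong (λ z → 2 + (c * z ^ d + c)) eq ⟩
  2 + (c * (2 ^ k) ^ d + c)              ≡⟨ cong (λ z → 2 + (c * z + c)) (^-*-assoc 2 k d) ⟩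
  2 + (c * 2 ^ (k * d) + c)              ≤⟨ +-monoʳ-≤ 2 (+-mono-≤ (*-monoˡ-≤ (2 ^ (k * d)) c≤) c≤′) ⟩
  2 + (2 ^ c * 2 ^ (k * d) + 2 ^ (c + k * d)) ≡⟨ cong (λ z → 2 + (z + 2 ^ (c + k * d))) (sym (^-distribˡ-+-* 2 c (k * d))) ⟩
  2 + (2 ^ (c + k * d) + 2 ^ (c + k * d))  ≡⟨ cong (2 +_) (2^-double (c + k * d)) ⟩
  2 + 2 ^ suc (c + k * d)                ≤⟨ +-monoˡ-≤ _ (^-monoʳ-≤ 2 {1} {suc (c + k * d)} (s≤s z≤n)) ⟩
  2 ^ suc (c + k * d) + 2 ^ suc (c + k * d) ≡⟨ 2^-double (suc (c + k * d)) ⟩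
  2 ^ (2 + (c + k * d))                  ∎
  where
  open ≤-Reasoning
  c≤ : c ≤ 2 ^ c
  c≤ = <⇒≤ (n<2^n c)
  c≤′ : c ≤ 2 ^ (c + k * d)
  c≤′ = ≤-trans c≤ (^-monoʳ-≤ 2 (m≤m+n c (k * d)))

fits-below : ∀ t a n → 2 + t ≤ 2 ^ a → 2 + (a + a + a) ≤ n → (2 + t) * (2 * (suc t * t) + 2) < 2 ^ n
fits-below t a n t≤ a≤ = begin-strict
  (2 + t) * (2 * (suc t * t) + 2)    ≤⟨ cube-bound t a t≤ ⟩
  2 ^ suc (a + a + a)                <⟨ ^-monoʳ-< 2 (s≤s (s≤s z≤n)) {suc (a + a + a)} ≤-refl ⟩
  2 ^ suc (suc (a + a + a))          ≤⟨ ^-monoʳ-≤ 2 a≤ ⟩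
  2 ^ n                              ∎
  where open ≤-Reasoning

regroup : ∀ c d lo j → suc (2 + ((2 + (c + (j + j) * d)) + (2 + (c + (j + j) * d)) + (2 + (c + (j + j) * d))) + lo)
                     ≡ suc (8 + (3 * c + lo)) + j * (6 * d)
regroup = solve-∀

abstract
 -- With `suc n` a power `2 ^ k`, the clock is below a power of two whose exponent `a` is linear in
 -- `k`, and the requirement becomes a comparison of exponents: `3 * a`, up to constants and `lo`,
 -- against `2 ^ k`.
 threshold : ∀ c d lo → ∃ λ n → lo ≤ n × (2 + clock c d n) * (2 * (suc (clock c d n) * clock c d n) + 2) < 2 ^ n
 threshold c d lo = n , lo≤n ,
   fits-below (clock c d n) a n (clock-bound c d k n 1+n≡2^k) (≤-trans (m≤m+n (2 + (a + a + a)) lo) big)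
  where
   open ≤-Reasoning
   w j k a n : ℕ
   -- `regroup` turns the left side into `suc w + j * (6 * d)`, and `j` is the sum of both
   -- coefficients, so `suc j * suc j` dominates it. Doubling `j` to `k` makes `2 ^ k` the square of
   -- `2 ^ j`, which covers that product.
   w = 8 + (3 * c + lo)
   j = 6 * d + w
   k = j + j
   a = 2 + (c + k * d)
   n = pred (2 ^ k)

   1+n≡2^k : suc n ≡ 2 ^ k
   1+n≡2^k = suc-pred (2 ^ k) {{m^n≢0 2 k}}

   big′ : suc (2 + (a + a + a) + lo) ≤ 2 ^ k
   big′ = begin
     suc (2 + (a + a + a) + lo)       ≡⟨ regroup c d lo j ⟩
     suc w + j * (6 * d)              ≤⟨ +-mono-≤ (s≤s (m≤n+m w (6 * d))) (*-monoʳ-≤ j (≤-trans (m≤m+n (6 * d) w) (n≤1+n j))) ⟩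
     suc j * suc j                    ≤⟨ *-mono-≤ (n<2^n j) (n<2^n j) ⟩
     2 ^ j * 2 ^ j                    ≡⟨ sym (^-distribˡ-+-* 2 j j) ⟩
     2 ^ k                            ∎

   big : 2 + (a + a + a) + lo ≤ n
   big = s≤s⁻¹ (≤-trans big′ (≤-reflexive (sym 1+n≡2^k)))

   lo≤n : lo ≤ n
   lo≤n = ≤-trans (m≤n+m lo _) big

-- The blocks of width at least low are still free.
record State : Set where
  constructor state
  field
    family : Family
    low    : ℕ
open State

word : ℕ → Str
word n = replicate (suc n) true

module Stage (i c d : ℕ) (st : State) where
  N : NOTM
  N = assemble (codes i)

  n t : ℕ
  n = proj₁ (threshold c d (low st))
  t = clock c d n

  open Adversary N (word n) n t (family st) public using (Fooled; Correct; fool)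

  -- If `N` is not robustly underproductive, every instance meets the requirement.
  choose : Fooled → Inst n
  choose (inj₁ (F , _)) = F
  choose (inj₂ _)       = trivial n

  fooled : (w : Fooled) → RobustlyUnderproductive N → ¬ Correct (choose w)
  fooled (inj₁ (_ , ¬correct)) under = ¬correct
  fooled (inj₂ ¬under)         under = ⊥-elim (¬under under)

  G : Inst n
  G = choose (fool (proj₂ (proj₂ (threshold c d (low st)))))

  -- The new `low` passes `n` and every width occurring in a query of length at most `1 + t`, so
  -- later stages change nothing that `N` can see on this input.
  advance : State
  advance = state (update (family st) n G) (suc n + (2 + t))

requirement : ℕ → ℕ × ℕ × ℕ
requirement = pair id (pair id id)

requirement-enumerates : Enumerates requirement
requirement-enumerates = pair-enumerates id-enumerates (pair-enumerates id-enumerates id-enumerates)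

nextState : ℕ × ℕ × ℕ → State → State
nextState (i , c , d) st = Stage.advance i c d st

stages : ℕ → State
stages zero    = state trivial 0
stages (suc s) = nextState (requirement s) (stages s)

-- `low` grows at every stage, so width `n` is frozen from stage `suc n` on.
limit : Family
limit n = family (stages (suc n)) n

update-≢ : ∀ I n (F : Inst n) {m} → n ≢ m → update I n F m ≡ I m
update-≢ I n F {m} n≢m with n ≟ m
... | yes n≡m = contradiction n≡m n≢m
... | no _    = refl

update-≡ : ∀ I n (F : Inst n) → update I n F n ≡ F
update-≡ I n F with n ≟ n
... | yes refl = refl
... | no n≢n   = contradiction refl n≢n

low-nextState : ∀ p st → low st < low (nextState p st)
low-nextState (i , c , d) st = s≤s (≤-trans (proj₁ (proj₂ (threshold c d (low st)))) (m≤m+n _ _))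

nextState-stable : ∀ p st {m} → m < low st → family (nextState p st) m ≡ family st m
nextState-stable (i , c , d) st m< = update-≢ _ _ _ (>⇒≢ (<-≤-trans m< (proj₁ (proj₂ (threshold c d (low st))))))

s≤low : ∀ s → s ≤ low (stages s)
s≤low zero    = z≤n
s≤low (suc s) = ≤-<-trans (s≤low s) (low-nextState (requirement s) (stages s))

stages-stable : ∀ {s s′ m} → s ≤′ s′ → m < low (stages s) →
                family (stages s′) m ≡ family (stages s) m × m < low (stages s′)
stages-stable ≤′-refl m< = refl , m<
stages-stable (≤′-step {s′} s≤) m< with stages-stable s≤ m<
... | eq , m<′ = trans (nextState-stable (requirement s′) (stages s′) m<′) eq
               , <-trans m<′ (low-nextState (requirement s′) (stages s′))

limit-stable : ∀ s {m} → m < low (stages s) → limit m ≡ family (stages s) m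
limit-stable s {m} m< with ≤-total (suc m) s
... | inj₁ m<s = sym (proj₁ (stages-stable (≤⇒≤′ m<s) (s≤low (suc m))))
... | inj₂ s≤m = proj₁ (stages-stable (≤⇒≤′ s≤m) m<)

-- On an input of length n + 1 the machine below uses its first cell as a left-end marker,
-- which leaves instance width n.
language : Family → Lang
language I x = even (e (I (pred (length x))))

width≤ : ∀ q → width q ≤ length q
width≤ []          = z≤n
width≤ (_ ∷ [])    = z≤n
width≤ (_ ∷ _ ∷ q) = s≤s (m≤n⇒m≤1+n (width≤ q))

decided : ∀ {N A B} → SNvia N A B → ∀ x → Out N B x (answer (A x))
decided {N} {A} {B} (_ , over , under , dec) x = go (A x) refl (over x)
  where
  go : ∀ b → A x ≡ b → Out N B x acc ⊎ Out N B x rej → Out N B x (answer b)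
  go true  eq _        = Equivalence.to (dec x) eq
  go false eq (inj₂ r) = r
  go false eq (inj₁ a) = contradiction (trans (sym eq) (Equivalence.from (dec x) a)) λ ()

-- Within its clock the machine asks only about widths where `I` already equals the family of the
-- stage. A correct answer relative to `oracle I` would thus be a correct answer on `G`, which the
-- stage has excluded.
defeat : ∀ {N} I i c d st → N ≈ assemble (codes i) →
         (∀ {m} → m < low (nextState (i , c , d) st) → I m ≡ family (nextState (i , c , d) st) m) →
         (∀ D x k c′ → Steps N D k (initCfg N x) c′ → k ≤ c * length x ^ d + c) →
         SNvia N (language I) (oracle I) → ¬ RobustlyUnderproductive N
defeat {N} I i c d st N≈ agree time sn under =
  fooled (fool (proj₂ (proj₂ (threshold c d (low st))))) under′ correct
  where
  open Stage i c d st renaming (N to N′)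
  under′ : RobustlyUnderproductive N′
  under′ D x (a , r) = under D x (≈-Out (≈-sym N≈) a , ≈-Out (≈-sym N≈) r)

  verdict : language I (word n) ≡ even (e G)
  verdict = trans (cong (λ m → even (e (I m))) (length-replicate n))
            (cong (even ∘ e) (trans (agree (s≤s (m≤m+n n _))) (update-≡ _ n G)))

  same : ∀ {q} → length q ≤ 1 + t → oracle I q ≡ oracle (update (family st) n G) q
  same {q} q≤ = cong (λ F → f F (row q) ≤ᵇ col q)
    (agree (s≤s (≤-trans (≤-trans (width≤ q) q≤) (≤-trans (n≤1+n (suc t)) (m≤n+m (2 + t) n)))))

  correct : Correct G
  correct = run (decided {N} {language I} {oracle I} sn (word n))
    where
    run : Out N (oracle I) (word n) (answer (language I (word n))) → Correct G
    run (k , c′ , s , h) = convert (≈-path {D = oracle I} {x = word n} N≈ s h)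
      where
      k≤t : k ≤ t
      k≤t = subst (λ l → k ≤ c * l ^ d + c) (cong suc (length-replicate n)) (time (oracle I) (word n) k c′ s)
      convert : (Σ (Config N′) λ c″ → Steps N′ (oracle I) k (initCfg N′ (word n)) c″ ×
                   NOTM.kind N′ (Config.state c″) ≡ halt (answer (language I (word n)))) → Correct G
      convert (c″ , s′ , h′) = k , k≤t , c″ ,
        Paths.transport N′ {oracle I} {oracle (update (family st) n G)} s′
          (λ {q} q∈ → same {q} (≤-trans (Paths.length-query N′ {oracle I} s′ q∈) (s≤s k≤t))) ,
        trans h′ (cong (λ b → halt (answer b)) verdict)

limit-≰RS : ¬ (language limit ≤RS oracle limit)
limit-≰RS (N , sn@((c , d , time) , _) , _ , under) = covered (machine-covers N)
  where
  covered : ¬ ∃ λ i → assemble (codes i) ≈ N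
  covered (i , N≈) = scheduled (requirement-enumerates (i , c , d))
    where
    scheduled : ¬ ∃ λ s → requirement s ≡ (i , c , d)
    scheduled (s , eq) = defeat limit i c d (stages s) (≈-sym N≈) agree time sn under
      where
      agree : ∀ {m} → m < low (nextState (i , c , d) (stages s)) → limit m ≡ family (nextState (i , c , d) (stages s)) m
      agree = subst (λ p → ∀ {m} → m < low (nextState p (stages s)) → limit m ≡ family (nextState p (stages s)) m)
                    eq (limit-stable (suc s))

-- A robustly overproductive machine for the sink

module Semantics (N : NOTM) where
  open NOTM N

  -- Uniqueness of the successor is kept with the step, so one deterministic run serves twice: as
  -- the witness that an outcome occurs, and as a description of all paths from its start.
  _⊢_⟶_ : Lang → Config N → Config N → Set
  D ⊢ c ⟶ c′ = Step N D c c′ × (∀ {c″} → Step N D c c″ → c″ ≡ c′)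

  data Run (D : Lang) : ℕ → Config N → Config N → Set where
    stay : ∀ {c} → Run D 0 c c
    _◅_  : ∀ {k c c′ c″} → D ⊢ c ⟶ c′ → Run D k c′ c″ → Run D (suc k) c c″

  infixr 5 _◅_ _◅◅_

  _◅◅_ : ∀ {D k l c c′ c″} → Run D k c c′ → Run D l c′ c″ → Run D (k + l) c c″
  stay    ◅◅ r′ = r′
  (s ◅ r) ◅◅ r′ = s ◅ (r ◅◅ r′)

  Halts : Lang → ℕ → Config N → Outcome → Set
  Halts D t c o = Σ ℕ λ k → k ≤ t × Σ (Config N) λ c′ → Run D k c c′ × kind (Config.state c′) ≡ halt o

  run-halts : ∀ {D k t c c′ o} → Run D k c c′ → Halts D t c′ o → Halts D (k + t) c o
  run-halts {k = k} r (l , l≤ , c″ , r′ , h) = k + l , +-monoʳ-≤ k l≤ , c″ , r ◅◅ r′ , h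

  halts-mono : ∀ {D t t′ c o} → t ≤ t′ → Halts D t c o → Halts D t′ c o
  halts-mono t≤ (k , k≤ , rest) = k , ≤-trans k≤ t≤ , rest

  Leads : Lang → Config N → Outcome → Set
  Leads D c o = Σ ℕ λ k → Σ (Config N) λ c′ → Steps N D k c c′ × kind (Config.state c′) ≡ halt o

  leads-step : ∀ {D c c′ o} → Step N D c c′ → Leads D c′ o → Leads D c o
  leads-step s (k , c″ , ss , h) = suc k , c″ , step s ss , h

  halts-leads : ∀ {D t c o} → Halts D t c o → Leads D c o
  halts-leads (k , _ , c′ , r , h) = k , c′ , steps r , h
    where
    steps : ∀ {D k c c′} → Run D k c c′ → Steps N D k c c′
    steps stay          = done
    steps ((s , _) ◅ r) = step s (steps r)

  -- Time and outcomes are bounded together: a trivial `P` gives the polynomial bound on every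
  -- oracle, and `Sound` gives correctness on honest ones.
  Safe : Lang → (Outcome → Set) → ℕ → Config N → Set
  Safe D P t c = ∀ {k c′} → Steps N D k c c′ → k ≤ t × (∀ {o} → kind (Config.state c′) ≡ halt o → P o)

  safe-step : ∀ {D P t c} → (∀ {o} → kind (Config.state c) ≢ halt o) →
              (∀ {c′} → Step N D c c′ → Safe D P t c′) → Safe D P (suc t) c
  safe-step ¬h safe done        = z≤n , λ h → contradiction h ¬h
  safe-step ¬h safe (step s ss) = s≤s (proj₁ (safe s ss)) , proj₂ (safe s ss)

  safe-mono : ∀ {D P t t′ c} → t ≤ t′ → Safe D P t c → Safe D P t′ c
  safe-mono t≤ safe ss = ≤-trans (proj₁ (safe ss)) t≤ , proj₂ (safe ss)

  halts-safe : ∀ {D P t c o} → Halts D t c o → P o → Safe D P t c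
  halts-safe {D} {P} {o = o} (_ , k≤ , c′ , r , h) po = safe-mono k≤ (run-safe r h)
    where
    run-safe : ∀ {k c c′} → Run D k c c′ → kind (Config.state c′) ≡ halt o → Safe D P k c
    run-safe stay h done       = z≤n , λ h′ → subst P (halt-injective (trans (sym h) h′)) po
      where
      halt-injective : ∀ {o o′} → halt o ≡ halt o′ → o ≡ o′
      halt-injective refl = refl
    run-safe stay h (step s _) = contradiction s (Paths.halted-no-step N h)
    run-safe ((s , uniq) ◅ r) h =
      safe-step (λ h′ → Paths.halted-no-step N h′ s) λ s′ → subst (Safe D P _) (sym (uniq s′)) (run-safe r h)

-- Every work cell after the marker holds guessed bits of y, w and z = w + 1, least
-- significant first.  Phases p₁, p₂, p₃ query (y , w), (y , z), (z , z).
data Phase : Set where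
  p₁ p₂ p₃ : Phase

-- The pending query is recorded at the right end of the work tape, because the control
-- state is lost when the oracle answers; eₘ is the query (y , w) for w = 2ⁿ - 1.
data Tag : Set where
  e₁ eₘ e₂ e₃ : Tag

Cell : Set
Cell = Bool × Bool × Bool

data Symbol : Set where
  void mark : Symbol
  bitₛ       : Bool → Symbol
  end        : Tag → Symbol
  cell       : Cell → Symbol

data Control : Set where
  launch peek asking gotYes gotNo : Control
  guess                    : Bool → Control
  back                     : Maybe Phase → Control
  copy copy′               : Phase → Control
  stop                     : Outcome → Control

encS : Symbol → Fin 16
encS void                         = # 0
encS (bitₛ false)                  = # 1
encS (bitₛ true)                   = # 2
encS mark                          = # 3
encS (end e₁)                      = # 4
encS (end eₘ)                      = # 5
encS (end e₂)                      = # 6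
encS (end e₃)                      = # 7
encS (cell (false , false , false)) = # 8
encS (cell (false , false , true))  = # 9
encS (cell (false , true , false))  = # 10
encS (cell (false , true , true))   = # 11
encS (cell (true , false , false))  = # 12
encS (cell (true , false , true))   = # 13
encS (cell (true , true , false))   = # 14
encS (cell (true , true , true))    = # 15

decS : Fin 16 → Symbol
decS = lookup (void ∷ bitₛ false ∷ bitₛ true ∷ mark ∷ end e₁ ∷ end eₘ ∷ end e₂ ∷ end e₃ ∷
  cell (false , false , false) ∷ cell (false , false , true) ∷ cell (false , true , false) ∷ cell (false , true , true) ∷
  cell (true , false , false) ∷ cell (true , false , true) ∷ cell (true , true , false) ∷ cell (true , true , true) ∷ [])

decS-encS : ∀ s → decS (encS s) ≡ s
decS-encS void                         = refl
decS-encS (bitₛ false)                  = refl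
decS-encS (bitₛ true)                   = refl
decS-encS mark                          = refl
decS-encS (end e₁)                      = refl
decS-encS (end eₘ)                      = refl
decS-encS (end e₂)                      = refl
decS-encS (end e₃)                      = refl
decS-encS (cell (false , false , false)) = refl
decS-encS (cell (false , false , true))  = refl
decS-encS (cell (false , true , false))  = refl
decS-encS (cell (false , true , true))   = refl
decS-encS (cell (true , false , false))  = refl
decS-encS (cell (true , false , true))   = refl
decS-encS (cell (true , true , false))   = refl
decS-encS (cell (true , true , true))    = refl

encC : Control → Fin 20
encC launch           = # 0
encC (guess false)    = # 1
encC (guess true)     = # 2
encC (back nothing)   = # 3
encC (back (just p₁)) = # 4
encC (back (just p₂)) = # 5
encC (back (just p₃)) = # 6
encC peek             = # 7
encC (copy p₁)        = # 8
encC (copy p₂)        = # 9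
encC (copy p₃)        = # 10
encC (copy′ p₁)       = # 11
encC (copy′ p₂)       = # 12
encC (copy′ p₃)       = # 13
encC asking           = # 14
encC gotYes              = # 15
encC gotNo               = # 16
encC (stop acc)       = # 17
encC (stop rej)       = # 18
encC (stop unk)       = # 19

decC : Fin 20 → Control
decC = lookup (launch ∷ guess false ∷ guess true ∷ back nothing ∷ back (just p₁) ∷ back (just p₂) ∷ back (just p₃) ∷
  peek ∷ copy p₁ ∷ copy p₂ ∷ copy p₃ ∷ copy′ p₁ ∷ copy′ p₂ ∷ copy′ p₃ ∷ asking ∷ gotYes ∷ gotNo ∷
  stop acc ∷ stop rej ∷ stop unk ∷ [])

decC-encC : ∀ q → decC (encC q) ≡ q
decC-encC launch           = refl
decC-encC (guess false)    = refl
decC-encC (guess true)     = refl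
decC-encC (back nothing)   = refl
decC-encC (back (just p₁)) = refl
decC-encC (back (just p₂)) = refl
decC-encC (back (just p₃)) = refl
decC-encC peek             = refl
decC-encC (copy p₁)        = refl
decC-encC (copy p₂)        = refl
decC-encC (copy p₃)        = refl
decC-encC (copy′ p₁)       = refl
decC-encC (copy′ p₂)       = refl
decC-encC (copy′ p₃)       = refl
decC-encC asking           = refl
decC-encC gotYes              = refl
decC-encC gotNo               = refl
decC-encC (stop acc)       = refl
decC-encC (stop rej)       = refl
decC-encC (stop unk)       = refl

kindOf : Control → Kind
kindOf asking   = query
kindOf (stop o) = halt o
kindOf _        = normal

fstBit sndBit : Phase → Cell → Bool
fstBit p₁ (y , w , z) = y
fstBit p₂ (y , w , z) = y
fstBit p₃ (y , w , z) = z
sndBit p₁ (y , w , z) = w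
sndBit p₂ (y , w , z) = z
sndBit p₃ (y , w , z) = z

matches : Phase → Tag → Bool
matches p₁ e₁ = true
matches p₁ eₘ = true
matches p₂ e₂ = true
matches p₃ e₃ = true
matches _  _  = false

arrive : Maybe Phase → Control
arrive nothing  = peek
arrive (just p) = copy p

Action : Set
Action = Control × Symbol × Move × Symbol × Move

quietly : Control → Symbol → Move → Action
quietly q s m = q , s , m , void , S

emit : Control → Symbol → Move → Bool → Action
emit q s m b = q , s , m , bitₛ b , R

-- Numbers are stored least significant bit first, so the parity of `z` sits in the first cell.
lastBit : Bool → Outcome
lastBit z = answer (not z)

act : Control → Symbol → Action
act launch    s                  = quietly (guess true) mark R
act (guess _) s                  = quietly (stop unk) s S
act (back p)  mark               = quietly (arrive p) mark R
act (back p)  s                  = quietly (back p) s L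
act peek (cell c@(_ , _ , z))    = quietly (stop (lastBit z)) (cell c) S
-- At width zero there is no cell and the head meets the tag; then `z = 0`, which is even.
act peek      s                  = quietly (stop acc) s S
act (copy p)  (cell c)           = emit (copy′ p) (cell c) S (fstBit p c)
act (copy p)  (end t)            = quietly (if matches p t then asking else stop unk) (end t) S
act (copy p)  s                  = quietly (stop unk) s S
act (copy′ p) (cell c)           = emit (copy p) (cell c) R (sndBit p c)
act (copy′ p) s                  = quietly (stop unk) s S
act gotYes       (end e₂)           = quietly (back (just p₃)) (end e₃) S
act gotYes       (end e₃)           = quietly (back nothing) (end e₃) S
act gotYes       s                  = quietly (stop unk) s S
act gotNo        (end e₁)           = quietly (back (just p₂)) (end e₂) S
-- The answer claims `f y > 2ⁿ - 1`, which exposes a dishonest oracle; either verdict other than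
-- `unk` is then admissible.
act gotNo        (end eₘ)           = quietly (stop acc) (end eₘ) S
act gotNo        s                  = quietly (stop unk) s S
act asking    s                  = quietly (stop unk) s S
act (stop o)  s                  = quietly (stop unk) s S

guessed : Bool → Bool → Bool → Action
guessed c y w = quietly (guess (c ∧ w)) (cell (y , w , w xor c)) R

-- The argument of guess is the carry of z = w + 1.  A carry out of the last cell means
-- w = 2ⁿ - 1 and z = 0, and then either f y > w or f 0 = 0 is checked instead.
acts : Control → Symbol → List⁺ Action
acts (guess c) (bitₛ _)  = guessed c false false ∷ guessed c false true ∷ guessed c true false ∷ guessed c true true ∷ []
acts (guess false) void = quietly (back (just p₁)) (end e₁) S ∷ []
acts (guess true)  void = quietly (back (just p₁)) (end eₘ) S ∷ quietly (back (just p₃)) (end e₃) S ∷ []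
acts q s                 = act q s ∷ []

encA : Action → Fin 20 × Fin 16 × Move × Fin 16 × Move
encA (q , s , d , s′ , d′) = encC q , encS s , d , encS s′ , d′

O : NOTM
O = record
  { nSt   = 19
  ; m     = 13
  ; start = encC launch
  ; qYes  = encC gotYes
  ; qNo   = encC gotNo
  ; kind  = λ q → kindOf (decC q)
  ; δ     = λ q s _ → encA (head (acts (decC q) (decS s))) ∷ map encA (tail (acts (decC q) (decS s)))
  }

open Semantics O

kind-encC : ∀ q → NOTM.kind O (encC q) ≡ kindOf q
kind-encC q = cong kindOf (decC-encC q)

δ-enc : ∀ q s b → toList (NOTM.δ O (encC q) (encS s) b) ≡ map encA (toList (acts q s))
δ-enc q s b = cong₂ (λ q s → map encA (toList (acts q s))) (decC-encC q) (decS-encS s)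

after : Action → Tape O → Tape O → Config O
after (q , s , d , s′ , d′) w qt = cfg (encC q) (writeMove O (encS s) d w) (writeMove O (encS s′) d′ qt)

module _ {D : Lang} (q : Control) (s : Symbol) {l r : List (Fin 16)} {qt : Tape O} where

  can-act : kindOf q ≡ normal → ∀ {a} → a ∈ toList (acts q s) →
            Step O D (cfg (encC q) (tape l (encS s) r) qt) (after a (tape l (encS s) r) qt)
  can-act k {a} a∈ = move (trans (kind-encC q) k) (subst (encA a ∈_) (sym (δ-enc q s (Tape.cur qt))) (∈-map⁺ encA a∈))

  must-act : kindOf q ≡ normal → ∀ {c} → Step O D (cfg (encC q) (tape l (encS s) r) qt) c →
             ∃ λ a → a ∈ toList (acts q s) × c ≡ after a (tape l (encS s) r) qt
  must-act k (move {t = u} _ u∈) with ∈-map⁻ encA (subst (u ∈_) (δ-enc q s (Tape.cur qt)) u∈)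
  ... | a , a∈ , u≡ = a , a∈ , cong (apply O (cfg (encC q) (tape l (encS s) r) qt)) u≡
  must-act k (ask k′) with () ← trans (sym k) (trans (sym (kind-encC q)) k′)

  acts-once : kindOf q ≡ normal → ∀ {a} → acts q s ≡ a ∷ [] →
              D ⊢ cfg (encC q) (tape l (encS s) r) qt ⟶ after a (tape l (encS s) r) qt
  acts-once k {a} eq = can-act k (subst (λ as → a ∈ toList as) (sym eq) (here refl)) , unique
    where
    unique : ∀ {c} → Step O D (cfg (encC q) (tape l (encS s) r) qt) c → c ≡ after a (tape l (encS s) r) qt
    unique st with must-act k st
    ... | b , b∈ , c≡ with subst (λ as → b ∈ toList as) eq b∈
    ... | here refl = c≡

at : List (Fin 16) → List (Fin 16) → Tape O
at l []      = tape l (encS void) []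
at l (s ∷ r) = tape l s r

writeMove-R : ∀ s l c r → writeMove O s R (tape l c r) ≡ at (s ∷ l) r
writeMove-R s l c []      = refl
writeMove-R s l c (_ ∷ _) = refl

cells : List Cell → List (Fin 16)
cells = map (encS ∘ cell)

bitsₛ : Str → List (Fin 16)
bitsₛ = map (encS ∘ bitₛ)

queryTape : List (Fin 16) → Tape O
queryTape qs = tape qs (encS void) []

bits : Phase → List Cell → Str
bits p []       = []
bits p (c ∷ cs) = fstBit p c ∷ sndBit p c ∷ bits p cs

label : List Cell → Outcome
label []                = acc
label ((_ , _ , z) ∷ _) = lastBit z

tip : Control → Tag → List Cell → Config O
tip q t rs = cfg (encC q) (tape (cells rs ++ [ encS mark ]) (encS (end t)) []) (emptyTape O)

reply : Bool → Tag → List Cell → Config O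
reply b t rs = cfg (if b then encC gotYes else encC gotNo)
                   (tape (cells rs ++ [ encS mark ]) (encS (end t)) []) (emptyTape O)

module _ {D : Lang} where

  back-run : ∀ p rs s r → acts (back p) s ≡ quietly (back p) s L ∷ [] →
             Run D (suc (length rs))
               (cfg (encC (back p)) (tape (cells rs ++ [ encS mark ]) (encS s) r) (emptyTape O))
               (cfg (encC (back p)) (tape [] (encS mark) (cells rs ʳ++ encS s ∷ r)) (emptyTape O))
  back-run p []       s r eq = acts-once (back p) s refl eq ◅ stay
  back-run p (c ∷ rs) s r eq = acts-once (back p) s refl eq ◅ back-run p rs (cell c) (encS s ∷ r) refl

  cells-reverse : ∀ rs ys → cells rs ʳ++ ys ≡ cells (reverse rs) ++ ys
  cells-reverse rs ys = trans (ʳ++-defn (cells rs)) (cong (_++ ys) (sym (reverse-map (encS ∘ cell) rs)))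

  home-run : ∀ p t rs → Run D (suc (length rs) + 1) (tip (back p) t rs)
               (cfg (encC (arrive p)) (at [ encS mark ] (cells (reverse rs) ++ [ encS (end t) ])) (emptyTape O))
  home-run p t rs = subst
    (λ ys → Run D (suc (length rs) + 1) (tip (back p) t rs) (cfg (encC (arrive p)) (at [ encS mark ] ys) (emptyTape O)))
    (cells-reverse rs _)
    (back-run p rs (end t) [] refl ◅◅
      subst (λ w → D ⊢ cfg (encC (back p)) (tape [] (encS mark) (cells rs ʳ++ [ encS (end t) ])) (emptyTape O) ⟶
                       cfg (encC (arrive p)) w (emptyTape O))
        (writeMove-R (encS mark) [] (encS mark) (cells rs ʳ++ [ encS (end t) ]))
        (acts-once (back p) mark {[]} {cells rs ʳ++ [ encS (end t) ]} {emptyTape O} refl refl) ◅ stay)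

  copy-run : ∀ p cs l qs r → Run D (length cs * 2)
               (cfg (encC (copy p)) (at l (cells cs ++ r)) (queryTape qs))
               (cfg (encC (copy p)) (at (cells cs ʳ++ l) r) (queryTape (bitsₛ (bits p cs) ʳ++ qs)))
  copy-run p []       l qs r = stay
  copy-run p (c ∷ cs) l qs r = acts-once (copy p) (cell c) refl refl ◅
    subst (λ w → D ⊢ half ⟶ cfg (encC (copy p)) w (queryTape (encS (bitₛ (sndBit p c)) ∷ encS (bitₛ (fstBit p c)) ∷ qs)))
      (writeMove-R (encS (cell c)) l (encS (cell c)) (cells cs ++ r))
      (acts-once (copy′ p) (cell c) {l} {cells cs ++ r} {queryTape (encS (bitₛ (fstBit p c)) ∷ qs)} refl refl) ◅ copy-run p cs _ _ r
    where
    half : Config O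
    half = cfg (encC (copy′ p)) (tape l (encS (cell c)) (cells cs ++ r)) (queryTape (encS (bitₛ (fstBit p c)) ∷ qs))

  -- The head stands one cell right of the last emitted bit, so the contents end in a blank, where
  -- reading stops.
  readBits-bitsₛ : ∀ bs → readBits O (bitsₛ bs ++ [ encS void ]) ≡ bs
  readBits-bitsₛ []           = refl
  readBits-bitsₛ (false ∷ bs) = cong (false ∷_) (readBits-bitsₛ bs)
  readBits-bitsₛ (true ∷ bs)  = cong (true ∷_) (readBits-bitsₛ bs)

  read-query : ∀ bs → readBits O (contents O (queryTape (bitsₛ bs ʳ++ []))) ≡ bs
  read-query bs = trans (cong (λ l → readBits O (l ++ [ encS void ])) (reverse-involutive (bitsₛ bs)))
                        (readBits-bitsₛ bs)

  asks : ∀ w qt → D ⊢ cfg (encC asking) w qt ⟶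
                  cfg (if D (readBits O (contents O qt)) then encC gotYes else encC gotNo) w (emptyTape O)
  asks w qt = ask refl , λ { (ask _) → refl }

  phase-run : ∀ p t rs → matches p t ≡ true →
              Run D (suc (length rs) + 1 + (length (reverse rs) * 2 + 2))
                (tip (back (just p)) t rs) (reply (D (bits p (reverse rs))) t rs)
  phase-run p t rs ok = home-run (just p) t rs ◅◅ copy-run p (reverse rs) _ _ _ ◅◅
    acts-once (copy p) (end t) refl
      (cong (λ b → quietly (if b then asking else stop unk) (end t) S ∷ []) ok) ◅
    subst (D ⊢ cfg (encC asking) atEnd written ⟶_) (cong₂ (λ q l → cfg (if D q then encC gotYes else encC gotNo) (tape l (encS (end t)) []) (emptyTape O))
        (read-query (bits p (reverse rs))) unreverse)
      (asks atEnd written) ◅ stay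
    where
    atEnd written : Tape O
    atEnd   = tape (cells (reverse rs) ʳ++ [ encS mark ]) (encS (end t)) []
    written = queryTape (bitsₛ (bits p (reverse rs)) ʳ++ [])
    unreverse : cells (reverse rs) ʳ++ [ encS mark ] ≡ cells rs ++ [ encS mark ]
    unreverse = trans (cells-reverse (reverse rs) _) (cong (λ l → cells l ++ [ encS mark ]) (reverse-involutive rs))

tip-normal : ∀ {q} → kindOf q ≡ normal → ∀ {o} → NOTM.kind O (encC q) ≢ halt o
tip-normal {q} k h with () ← trans (sym k) (trans (sym (kind-encC q)) h)

module _ {D : Lang} where

  stops : ∀ {t} o w qt → Halts D t (cfg (encC (stop o)) w qt) o
  stops o w qt = 0 , z≤n , _ , stay , kind-encC (stop o)

  peek-halts : ∀ cs t → Halts D 1 (cfg (encC peek) (at [ encS mark ] (cells cs ++ [ encS (end t) ])) (emptyTape O)) (label cs)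
  peek-halts []       t = run-halts (acts-once peek (end t) refl refl ◅ stay) (stops {0} acc _ _)
  peek-halts (c@(_ , _ , z) ∷ cs) t = run-halts (acts-once peek (cell c) refl refl ◅ stay) (stops {0} (lastBit z) _ _)

  label-halts : ∀ t rs → Halts D (suc (length rs) + 1 + 1) (tip (back nothing) t rs) (label (reverse rs))
  label-halts t rs = run-halts (home-run nothing t rs) (peek-halts (reverse rs) t)

  -- The result of the deterministic part, with `b` the answer to the query pending under the tag.
  -- Soundness and totality reduce to statements about this function.
  response : Tag → Bool → List Cell → Outcome
  response e₁ b cs = if b then unk else (if D (bits p₂ cs) then (if D (bits p₃ cs) then label cs else unk) else unk)
  response eₘ b cs = if b then unk else acc
  response e₂ b cs = if b then (if D (bits p₃ cs) then label cs else unk) else unk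
  response e₃ b cs = if b then label cs else unk

  module _ (rs : List Cell) where
    private
      n K : ℕ
      n = length rs
      K = suc n + 1 + (length (reverse rs) * 2 + 2)

    reply₃ : ∀ b → Halts D (1 + (suc n + 1 + 1)) (reply b e₃ rs) (response e₃ b (reverse rs))
    reply₃ true  = run-halts (acts-once gotYes (end e₃) refl refl ◅ stay) (label-halts e₃ rs)
    reply₃ false = run-halts (acts-once gotNo (end e₃) refl refl ◅ stay) (stops {suc n + 1 + 1} unk (tape _ _ _) (emptyTape O))

    T₃ T₂ T₁ : ℕ
    T₃ = K + (1 + (suc n + 1 + 1))
    T₂ = K + (1 + T₃)
    T₁ = K + (1 + T₂)

    T₃≤T₁ : T₃ ≤ T₁
    T₃≤T₁ = ≤-trans (≤-trans (n≤1+n T₃) (m≤n+m (1 + T₃) K)) (≤-trans (n≤1+n T₂) (m≤n+m (1 + T₂) K))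

    phase₃ : Halts D T₃ (tip (back (just p₃)) e₃ rs) (response e₃ (D (bits p₃ (reverse rs))) (reverse rs))
    phase₃ = run-halts (phase-run p₃ e₃ rs refl) (reply₃ _)

    reply₂ : ∀ b → Halts D (1 + T₃) (reply b e₂ rs) (response e₂ b (reverse rs))
    reply₂ true  = run-halts (acts-once gotYes (end e₂) refl refl ◅ stay) phase₃
    reply₂ false = run-halts (acts-once gotNo (end e₂) refl refl ◅ stay) (stops {T₃} unk (tape _ _ _) (emptyTape O))

    phase₂ : Halts D T₂ (tip (back (just p₂)) e₂ rs) (response e₂ (D (bits p₂ (reverse rs))) (reverse rs))
    phase₂ = run-halts (phase-run p₂ e₂ rs refl) (reply₂ _)

    reply₁ : ∀ b → Halts D (1 + T₂) (reply b e₁ rs) (response e₁ b (reverse rs))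
    reply₁ true  = run-halts (acts-once gotYes (end e₁) refl refl ◅ stay) (stops {T₂} unk (tape _ _ _) (emptyTape O))
    reply₁ false = run-halts (acts-once gotNo (end e₁) refl refl ◅ stay) phase₂

    replyₘ : ∀ b → Halts D (1 + T₂) (reply b eₘ rs) (response eₘ b (reverse rs))
    replyₘ true  = run-halts (acts-once gotYes (end eₘ) refl refl ◅ stay) (stops {T₂} unk (tape _ _ _) (emptyTape O))
    replyₘ false = run-halts (acts-once gotNo (end eₘ) refl refl ◅ stay) (stops {T₂} acc (tape _ _ _) (emptyTape O))

    phase₁ : Halts D T₁ (tip (back (just p₁)) e₁ rs) (response e₁ (D (bits p₁ (reverse rs))) (reverse rs))
    phase₁ = run-halts (phase-run p₁ e₁ rs refl) (reply₁ _)

    phaseₘ : Halts D T₁ (tip (back (just p₁)) eₘ rs) (response eₘ (D (bits p₁ (reverse rs))) (reverse rs))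
    phaseₘ = run-halts (phase-run p₁ eₘ rs refl) (replyₘ _)

fill : Bool → List (Bool × Bool) → List Cell
fill c []            = []
fill c ((y , w) ∷ g) = (y , w , w xor c) ∷ fill (c ∧ w) g

carry : Bool → List (Bool × Bool) → Bool
carry c []            = c
carry c ((y , w) ∷ g) = carry (c ∧ w) g

guessing : Bool → List Cell → List (Fin 16) → Config O
guessing c rs r = cfg (encC (guess c)) (at (cells rs ++ [ encS mark ]) r) (emptyTape O)

module _ {D : Lang} where

  guess-to : ∀ c b y w rs r → Step O D (guessing c rs (encS (bitₛ b) ∷ r)) (guessing (c ∧ w) ((y , w , w xor c) ∷ rs) r)
  guess-to c b y w rs r =
    subst (λ t → Step O D (guessing c rs (encS (bitₛ b) ∷ r)) (cfg (encC (guess (c ∧ w))) t (emptyTape O)))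
          (writeMove-R _ _ _ r) (can-act (guess c) (bitₛ b) refl (offered y w))
    where
    offered : ∀ y w → guessed c y w ∈ toList (acts (guess c) (bitₛ b))
    offered false false = here refl
    offered false true  = there (here refl)
    offered true  false = there (there (here refl))
    offered true  true  = there (there (there (here refl)))

  guess-from : ∀ c b rs r {c′} → Step O D (guessing c rs (encS (bitₛ b) ∷ r)) c′ →
               ∃ λ y → ∃ λ w → c′ ≡ guessing (c ∧ w) ((y , w , w xor c) ∷ rs) r
  guess-from c b rs r {c′} st = pick (must-act (guess c) (bitₛ b) refl st)
    where
    landed : ∀ y w → c′ ≡ after (guessed c y w) (at (cells rs ++ [ encS mark ]) (encS (bitₛ b) ∷ r)) (emptyTape O) →
             c′ ≡ guessing (c ∧ w) ((y , w , w xor c) ∷ rs) r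
    landed y w eq = trans eq (cong (λ t → cfg (encC (guess (c ∧ w))) t (emptyTape O)) (writeMove-R _ _ _ r))
    pick : (∃ λ a → a ∈ toList (acts (guess c) (bitₛ b)) ×
                    c′ ≡ after a (at (cells rs ++ [ encS mark ]) (encS (bitₛ b) ∷ r)) (emptyTape O)) →
           ∃ λ y → ∃ λ w → c′ ≡ guessing (c ∧ w) ((y , w , w xor c) ∷ rs) r
    pick (_ , here refl                         , eq) = false , false , landed false false eq
    pick (_ , there (here refl)                 , eq) = false , true  , landed false true eq
    pick (_ , there (there (here refl))         , eq) = true  , false , landed true false eq
    pick (_ , there (there (there (here refl))) , eq) = true  , true  , landed true true eq

  guess-leads : ∀ {o} g v c rs → length g ≡ length v →
                Leads D (guessing (carry c g) (fill c g ʳ++ rs) []) o → Leads D (guessing c rs (bitsₛ v)) o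
  guess-leads []            []      c rs eq l = l
  guess-leads ((y , w) ∷ g) (b ∷ v) c rs eq l =
    leads-step (guess-to c b y w rs (bitsₛ v)) (guess-leads g v (c ∧ w) _ (suc-injective eq) l)

  guess-safe : ∀ {P T} v c rs →
               (∀ g → length g ≡ length v → Safe D P T (guessing (carry c g) (fill c g ʳ++ rs) [])) →
               Safe D P (length v + T) (guessing c rs (bitsₛ v))
  guess-safe         []      c rs safe = safe [] refl
  guess-safe {P} {T} (b ∷ v) c rs safe = safe-step (tip-normal {guess c} refl) λ st → next (guess-from c b rs (bitsₛ v) st)
    where
    next : ∀ {c′} → (∃ λ y → ∃ λ w → c′ ≡ guessing (c ∧ w) ((y , w , w xor c) ∷ rs) (bitsₛ v)) →
           Safe D P (length v + T) c′
    next (y , w , refl) = guess-safe v (c ∧ w) _ λ g eq → safe ((y , w) ∷ g) (cong suc eq)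

-- Soundness and running time

bitSym-encS : ∀ b → bitSym O b ≡ encS (bitₛ b)
bitSym-encS false = refl
bitSym-encS true  = refl

module _ {D : Lang} where

  init-run : ∀ x → Run D 1 (initCfg O x) (guessing true [] (bitsₛ (drop 1 x)))
  init-run []      = acts-once launch void refl refl ◅ stay
  init-run (b ∷ x) =
    subst₂ (λ s r → Run D 1 (cfg (encC launch) (tape [] s r) (emptyTape O)) (guessing true [] (bitsₛ x)))
           (sym (bitSym-encS b)) (sym (map-cong bitSym-encS x))
           (subst (λ w → D ⊢ cfg (encC launch) (tape [] (encS (bitₛ b)) (bitsₛ x)) (emptyTape O) ⟶
                             cfg (encC (guess true)) w (emptyTape O))
                  (writeMove-R (encS mark) [] (encS (bitₛ b)) (bitsₛ x))
                  (acts-once launch (bitₛ b) {[]} {bitsₛ x} {emptyTape O} refl refl) ◅ stay)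

  no-carry : ∀ rs → D ⊢ guessing false rs [] ⟶ tip (back (just p₁)) e₁ rs
  no-carry rs = acts-once (guess false) void refl refl

  carry-max : ∀ rs → Step O D (guessing true rs []) (tip (back (just p₁)) eₘ rs)
  carry-max rs = can-act (guess true) void refl (here refl)

  carry-zero : ∀ rs → Step O D (guessing true rs []) (tip (back (just p₃)) e₃ rs)
  carry-zero rs = can-act (guess true) void refl (there (here refl))

  finish-safe : ∀ {P} c rs →
    (c ≡ false → P (response {D} e₁ (D (bits p₁ (reverse rs))) (reverse rs))) →
    (c ≡ true → P (response {D} eₘ (D (bits p₁ (reverse rs))) (reverse rs)) ×
                P (response {D} e₃ (D (bits p₃ (reverse rs))) (reverse rs))) →
    Safe D P (suc (T₁ {D} rs)) (guessing c rs [])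
  finish-safe {P} false rs h _ = halts-safe (run-halts (no-carry rs ◅ stay) (phase₁ rs)) (h refl)
  finish-safe {P} true  rs _ h = safe-step (tip-normal {guess true} refl) λ st → next (must-act (guess true) void refl st)
    where
    next : ∀ {c′} → (∃ λ a → a ∈ toList (acts (guess true) void) ×
                       c′ ≡ after a (at (cells rs ++ [ encS mark ]) []) (emptyTape O)) → Safe D P (T₁ {D} rs) c′
    next (_ , here refl , refl)         = halts-safe (phaseₘ rs) (proj₁ (h refl))
    next (_ , there (here refl) , refl) = halts-safe (halts-mono (T₃≤T₁ {D} rs) (phase₃ rs)) (proj₂ (h refl))

finish-time : ℕ → ℕ
finish-time n = 18 + 10 * n

T₁≡ : ∀ {D} rs → T₁ {D} rs ≡ finish-time (length rs)
T₁≡ rs rewrite length-reverse rs = sum (length rs)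
  where
  sum : ∀ n → suc n + 1 + (n * 2 + 2) + (1 + (suc n + 1 + (n * 2 + 2) +
                (1 + (suc n + 1 + (n * 2 + 2) + (1 + (suc n + 1 + 1)))))) ≡ 18 + 10 * n
  sum = solve-∀

length-fill : ∀ c g → length (fill c g) ≡ length g
length-fill c []      = refl
length-fill c (_ ∷ g) = cong suc (length-fill _ g)

run-safe : ∀ {D P} x →
  (∀ g → length g ≡ length (drop 1 x) → let cs = fill true g in
     (carry true g ≡ false → P (response {D} e₁ (D (bits p₁ cs)) cs)) ×
     (carry true g ≡ true → P (response {D} eₘ (D (bits p₁ cs)) cs) × P (response {D} e₃ (D (bits p₃ cs)) cs))) →
  Safe D P (suc (length (drop 1 x) + suc (finish-time (length (drop 1 x))))) (initCfg O x)
run-safe {D} {P} x good = run-then (init-run x) (guess-safe (drop 1 x) true [] finish)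
  where
  run-then : ∀ {c c′ t} → Run D 1 c c′ → Safe D P t c′ → Safe D P (suc t) c
  run-then ((s , uniq) ◅ stay) safe =
    safe-step (λ h → Paths.halted-no-step O h s) λ s′ → subst (Safe D P _) (sym (uniq s′)) safe

  finish : ∀ g → length g ≡ length (drop 1 x) →
           Safe D P (suc (finish-time (length (drop 1 x)))) (guessing (carry true g) (fill true g ʳ++ []) [])
  finish g eq = subst (λ t → Safe D P (suc t) (guessing (carry true g) (reverse cs) []))
    (trans (T₁≡ {D} (reverse cs)) (cong finish-time (trans (length-reverse cs) (trans (length-fill true g) eq))))
    (finish-safe (carry true g) (reverse cs)
      (subst (λ ds → carry true g ≡ false → P (response {D} e₁ (D (bits p₁ ds)) ds)) (sym twice) (proj₁ (good g eq)))
      (subst (λ ds → carry true g ≡ true → P (response {D} eₘ (D (bits p₁ ds)) ds) × P (response {D} e₃ (D (bits p₃ ds)) ds))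
             (sym twice) (proj₂ (good g eq))))
    where
    cs : List Cell
    cs = fill true g
    twice : reverse (reverse cs) ≡ cs
    twice = reverse-involutive cs

length-tail : ∀ (x : Str) → length (drop 1 x) ≡ pred (length x)
length-tail []      = refl
length-tail (_ ∷ _) = refl

O-isNPTM : IsNPTM O
-- With `m` the length of the tail of `x`, the run takes at most `20 + 11 * m` steps; `9 * m` is
-- added to reach the required form.
O-isNPTM = 20 , 1 , λ D x k c′ s → ≤-trans (proj₁ (run-safe {D} {λ _ → ⊤} x (λ _ _ → (λ _ → tt) , λ _ → tt , tt) s)) (bound x)
  where
  open ≤-Reasoning
  sum : ∀ n → 1 + (n + (1 + (18 + 10 * n))) + 9 * n ≡ 20 * (n * 1) + 20
  sum = solve-∀
  bound : ∀ x → suc (length (drop 1 x) + suc (finish-time (length (drop 1 x)))) ≤ 20 * length x ^ 1 + 20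
  bound x = begin
    _                            ≤⟨ m≤m+n _ (9 * length (drop 1 x)) ⟩
    _                            ≡⟨ sum (length (drop 1 x)) ⟩
    20 * (length (drop 1 x) * 1) + 20  ≤⟨ +-monoˡ-≤ 20 (*-monoʳ-≤ 20 (*-monoˡ-≤ 1 shorter)) ⟩
    20 * length x ^ 1 + 20             ∎
    where
    shorter : length (drop 1 x) ≤ length x
    shorter = ≤-trans (≤-reflexive (length-tail x)) pred[n]≤n

-- Little-endian binary increment

inc : Bool → Str → Str
inc c []       = []
inc c (w ∷ ws) = (w xor c) ∷ inc (c ∧ w) ws

over : Bool → Str → Bool
over c []       = c
over c (w ∷ ws) = over (c ∧ w) ws

length-inc : ∀ c ws → length (inc c ws) ≡ length ws
length-inc c []       = refl
length-inc c (w ∷ ws) = cong suc (length-inc (c ∧ w) ws)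

half-adder : ∀ c w → bit (w xor c) + 2 * bit (c ∧ w) ≡ bit c + bit w
half-adder false false = refl
half-adder false true  = refl
half-adder true  false = refl
half-adder true  true  = refl

-- Ripple-carry addition preserves the total, with the outgoing carry weighing `2 ^ length ws`.
val-inc : ∀ c ws → val (inc c ws) + 2 ^ length ws * bit (over c ws) ≡ bit c + val ws
val-inc c []       = trans (+-identityʳ (bit c)) (sym (+-identityʳ (bit c)))
val-inc c (w ∷ ws) = begin
  s + 2 * v + 2 * p * o       ≡⟨ collect s v p o ⟩
  s + 2 * (v + p * o)         ≡⟨ cong (λ z → s + 2 * z) (val-inc (c ∧ w) ws) ⟩
  s + 2 * (bit (c ∧ w) + val ws) ≡⟨ split s (bit (c ∧ w)) (val ws) ⟩
  s + 2 * bit (c ∧ w) + 2 * val ws ≡⟨ cong (_+ 2 * val ws) (half-adder c w) ⟩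
  bit c + bit w + 2 * val ws  ≡⟨ +-assoc (bit c) (bit w) _ ⟩
  bit c + (bit w + 2 * val ws) ∎
  where
  open ≡-Reasoning
  s v p o : ℕ
  s = bit (w xor c)
  v = val (inc (c ∧ w) ws)
  p = 2 ^ length ws
  o = bit (over (c ∧ w) ws)
  collect : ∀ s v p o → s + 2 * v + 2 * p * o ≡ s + 2 * (v + p * o)
  collect = solve-∀
  split : ∀ s b v → s + 2 * (b + v) ≡ s + 2 * b + 2 * v
  split = solve-∀

inc-exact : ∀ bs → over true bs ≡ false → val (inc true bs) ≡ suc (val bs)
inc-exact bs eq = begin
  val (inc true bs)                                      ≡⟨ sym (+-identityʳ _) ⟩
  val (inc true bs) + 0                                  ≡⟨ cong (val (inc true bs) +_) (sym (*-zeroʳ p)) ⟩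
  val (inc true bs) + p * 0                              ≡⟨ cong (λ b → val (inc true bs) + p * bit b) (sym eq) ⟩
  val (inc true bs) + p * bit (over true bs)             ≡⟨ val-inc true bs ⟩
  suc (val bs)                                           ∎
  where
  open ≡-Reasoning
  p : ℕ
  p = 2 ^ length bs

inc-wraps : ∀ n bs → length bs ≡ n → over true bs ≡ true → val (inc true bs) + 2 ^ n ≡ suc (val bs)
inc-wraps n bs refl eq = begin
  val (inc true bs) + 2 ^ n                      ≡⟨ cong (val (inc true bs) +_) (sym (*-identityʳ (2 ^ n))) ⟩
  val (inc true bs) + 2 ^ n * 1                  ≡⟨ cong (λ b → val (inc true bs) + 2 ^ n * bit b) (sym eq) ⟩
  val (inc true bs) + 2 ^ n * bit (over true bs) ≡⟨ val-inc true bs ⟩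
  suc (val bs)                                   ∎
  where open ≡-Reasoning

val<2^ : ∀ ws → val ws < 2 ^ length ws
val<2^ []       = s≤s z≤n
val<2^ (w ∷ ws) = begin-strict
  bit w + 2 * val ws       ≤⟨ +-monoˡ-≤ (2 * val ws) (bit≤1 w) ⟩
  1 + 2 * val ws           <⟨ ≤-refl ⟩
  2 + 2 * val ws           ≡⟨ sym (*-suc 2 (val ws)) ⟩
  2 * suc (val ws)         ≤⟨ *-monoʳ-≤ 2 (val<2^ ws) ⟩
  2 * 2 ^ length ws        ∎
  where
  open ≤-Reasoning
  bit≤1 : ∀ w → bit w ≤ 1
  bit≤1 true  = ≤-refl
  bit≤1 false = z≤n

ys ws : List (Bool × Bool) → Str
ys = map proj₁
ws = map proj₂

carry≡over : ∀ c g → carry c g ≡ over c (ws g)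
carry≡over c []            = refl
carry≡over c ((_ , w) ∷ g) = carry≡over (c ∧ w) g

inter : Str → Str → Str
inter (a ∷ as) (b ∷ bs) = a ∷ b ∷ inter as bs
inter _        _        = []

bits₁ : ∀ c g → bits p₁ (fill c g) ≡ inter (ys g) (ws g)
bits₁ c []            = refl
bits₁ c ((y , w) ∷ g) = cong (λ q → y ∷ w ∷ q) (bits₁ (c ∧ w) g)

bits₂ : ∀ c g → bits p₂ (fill c g) ≡ inter (ys g) (inc c (ws g))
bits₂ c []            = refl
bits₂ c ((y , w) ∷ g) = cong (λ q → y ∷ (w xor c) ∷ q) (bits₂ (c ∧ w) g)

bits₃ : ∀ c g → bits p₃ (fill c g) ≡ inter (inc c (ws g)) (inc c (ws g))
bits₃ c []            = refl
bits₃ c ((y , w) ∷ g) = cong (λ q → (w xor c) ∷ (w xor c) ∷ q) (bits₃ (c ∧ w) g)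

even-val : ∀ b v → even (bit b + 2 * v) ≡ not b
even-val b v rewrite *-comm 2 v = go b v
  where
  go : ∀ b v → even (bit b + v * 2) ≡ not b
  go true  zero    = refl
  go false zero    = refl
  go true  (suc v) = go true v
  go false (suc v) = go false v

label-fill : ∀ c g → label (fill c g) ≡ answer (even (val (inc c (ws g))))
label-fill c []            = refl
label-fill c ((y , w) ∷ g) = cong answer (sym (even-val (w xor c) (val (inc (c ∧ w) (ws g)))))

pairs-inter : ∀ as bs → length as ≡ length bs → pairs (inter as bs) ≡ zip as bs
pairs-inter []       []       eq = refl
pairs-inter (a ∷ as) (b ∷ bs) eq = cong ((a , b) ∷_) (pairs-inter as bs (suc-injective eq))

map-proj₁-zip : ∀ (as bs : Str) → length as ≡ length bs → map proj₁ (zip as bs) ≡ as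
map-proj₁-zip []       []       eq = refl
map-proj₁-zip (a ∷ as) (b ∷ bs) eq = cong (a ∷_) (map-proj₁-zip as bs (suc-injective eq))

map-proj₂-zip : ∀ (as bs : Str) → length as ≡ length bs → map proj₂ (zip as bs) ≡ bs
map-proj₂-zip []       []       eq = refl
map-proj₂-zip (a ∷ as) (b ∷ bs) eq = cong (b ∷_) (map-proj₂-zip as bs (suc-injective eq))

length-zip-≡ : ∀ (as bs : Str) → length as ≡ length bs → length (zip as bs) ≡ length as
length-zip-≡ as bs eq = trans (sym (length-map proj₁ (zip as bs))) (cong length (map-proj₁-zip as bs eq))

oracle-inter : ∀ I as bs → length as ≡ length bs →
               oracle I (inter as bs) ≡ (f (I (length as)) (val as) ≤ᵇ val bs)
oracle-inter I as bs eq
  rewrite pairs-inter as bs eq | map-proj₁-zip as bs eq | map-proj₂-zip as bs eq | length-zip-≡ as bs eq = refl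

≤ᵇ-true : ∀ {m n} → (m ≤ᵇ n) ≡ true → m ≤ n
≤ᵇ-true {m} {n} eq = ≤ᵇ⇒≤ m n (subst T (sym eq) tt)

≤ᵇ-false : ∀ {m n} → (m ≤ᵇ n) ≡ false → n < m
≤ᵇ-false eq = ≰⇒> λ m≤n → subst T eq (≤⇒≤ᵇ m≤n)

-- Correctness on path instances

Sound : Bool → Outcome → Set
Sound b o = o ≡ unk ⊎ o ≡ answer b

when-true : ∀ {a o} b → (b ≡ true → Sound a o) → Sound a (if b then o else unk)
when-true true  h = h refl
when-true false h = inj₁ refl

when-false : ∀ {a o} b → (b ≡ false → Sound a o) → Sound a (if b then unk else o)
when-false true  h = inj₁ refl
when-false false h = h refl

module _ (I : Family) (x : Str) where
  private
    n : ℕ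
    n = length (drop 1 x)
    F : Inst n
    F = I n
    D : Lang
    D = oracle I

  module _ (g : List (Bool × Bool)) (|g| : length g ≡ n) where
    private
      Y W Z : Str
      Y = ys g
      W = ws g
      Z = inc true W
      |Y| : length Y ≡ n
      |Y| = trans (length-map proj₁ g) |g|
      |W| : length W ≡ n
      |W| = trans (length-map proj₂ g) |g|
      |Z| : length Z ≡ n
      |Z| = trans (length-inc true W) |W|
      cs : List Cell
      cs = fill true g

    answers : ∀ {q as bs} → q ≡ inter as bs → length as ≡ n → length bs ≡ n → D q ≡ (f F (val as) ≤ᵇ val bs)
    answers {as = as} {bs} refl |as| |bs| = trans (oracle-inter I as bs (trans |as| (sym |bs|)))
      (cong (λ m → f (I m) (val as) ≤ᵇ val bs) |as|)

    answer₁ : D (bits p₁ cs) ≡ (f F (val Y) ≤ᵇ val W)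
    answer₁ = answers {as = Y} (bits₁ true g) |Y| |W|

    answer₂ : D (bits p₂ cs) ≡ (f F (val Y) ≤ᵇ val Z)
    answer₂ = answers {as = Y} (bits₂ true g) |Y| |Z|

    answer₃ : D (bits p₃ cs) ≡ (f F (val Z) ≤ᵇ val Z)
    answer₃ = answers {as = Z} (bits₃ true g) |Z| |Z|

    labelled : val Z ≡ e F → Sound (even (e F)) (label cs)
    labelled eq = inj₂ (trans (label-fill true g) (cong (answer ∘ even) eq))

    -- The first two answers squeeze `f y` to exactly `w + 1 = z`, which is positive; the third says
    -- that the path does not rise from `z`, so `sink` applies.
    sound₁ : carry true g ≡ false → Sound (even (e F)) (response {D} e₁ (D (bits p₁ cs)) cs)
    sound₁ no-over = when-false (D (bits p₁ cs)) λ q₁ → when-true (D (bits p₂ cs)) λ q₂ →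
      when-true (D (bits p₃ cs)) λ q₃ → labelled (found (≤ᵇ-false (trans (sym answer₁) q₁))
        (≤ᵇ-true (trans (sym answer₂) q₂)) (≤ᵇ-true (trans (sym answer₃) q₃)))
      where
      Z≡ : val Z ≡ suc (val W)
      Z≡ = inc-exact W (trans (sym (carry≡over true g)) no-over)
      found : val W < f F (val Y) → f F (val Y) ≤ val Z → f F (val Z) ≤ val Z → val Z ≡ e F
      found W< ≤Z fZ≤ = trans (sym fY≡) (sink F (val Y) (≤-<-trans z≤n W<)
                          (subst (λ z → f F z ≤ z) (sym fY≡) fZ≤))
        where
        fY≡ : f F (val Y) ≡ val Z
        fY≡ = ≤-antisym ≤Z (subst (_≤ f F (val Y)) (sym Z≡) W<)

    module _ (is-over : carry true g ≡ true) where
      wrapped : val Z + 2 ^ n ≡ suc (val W)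
      wrapped = inc-wraps n W |W| (trans (sym (carry≡over true g)) is-over)

      suc-W≤ : suc (val W) ≤ 2 ^ n
      suc-W≤ = subst (λ m → val W < 2 ^ m) |W| (val<2^ W)

      Z≡0 : val Z ≡ 0
      Z≡0 = n≤0⇒n≡0 (+-cancelʳ-≤ (2 ^ n) (val Z) 0 (≤-trans (≤-reflexive wrapped) suc-W≤))

      -- Overflow forces `w = 2ⁿ - 1`, and no value of an honest `f` exceeds that.
      soundₘ : Sound (even (e F)) (response {D} eₘ (D (bits p₁ cs)) cs)
      soundₘ = when-false (D (bits p₁ cs)) λ q₁ → contradiction
        (≤-trans (≤ᵇ-false (trans (sym answer₁) q₁)) (f≤e F (val Y)))
        (<⇒≱ (<-≤-trans (e<2^n F) (≤-trans (m≤n+m (2 ^ n) (val Z)) (≤-reflexive wrapped))))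

      -- Overflow makes `z = 0`, so the query asks whether `f 0 ≤ 0`, and `source` identifies the
      -- end.
      sound₃ : Sound (even (e F)) (response {D} e₃ (D (bits p₃ cs)) cs)
      sound₃ = when-true (D (bits p₃ cs)) λ q₃ → labelled (trans Z≡0 (sym (source F
        (n≤0⇒n≡0 (subst (λ z → f F z ≤ z) Z≡0 (≤ᵇ-true (trans (sym answer₃) q₃)))))))

  O-sound : ∀ {o} → Out O (oracle I) x o → Sound (language I x) o
  O-sound {o} (k , c , s , h) = subst (λ m → Sound (even (e (I m))) o) (length-tail x)
    (proj₂ (run-safe {D} {Sound (even (e F))} x
      (λ g |g| → sound₁ g |g| , λ is-over → soundₘ g |g| is-over , sound₃ g |g| is-over) s) h)

-- Totality

-- Defined by repeated `inc`, so that the machine's `z` for the guess `bin n w` is `bin n (suc w)`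
-- by computation.
bin : ℕ → ℕ → Str
bin n zero    = replicate n false
bin n (suc k) = inc true (bin n k)

length-bin : ∀ n k → length (bin n k) ≡ n
length-bin n zero    = length-replicate n
length-bin n (suc k) = trans (length-inc true (bin n k)) (length-bin n k)

val-zeros : ∀ n → val (replicate n false) ≡ 0
val-zeros zero    = refl
val-zeros (suc n) = cong (2 *_) (val-zeros n)

zeros : ∀ bs → val bs ≡ 0 → bs ≡ replicate (length bs) false
zeros []           eq = refl
zeros (false ∷ bs) eq = cong (false ∷_) (zeros bs (m+n≡0⇒m≡0 (val bs) eq))

mutual
  -- The increment is exact unless it overflows, and an overflow from `bin n k` would need `suc k`
  -- to be at least `2 ^ n`; each fact at `k` feeds the other.
  val-bin : ∀ n k → k < 2 ^ n → val (bin n k) ≡ k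
  val-bin n zero    k< = val-zeros n
  val-bin n (suc k) k< = trans (inc-exact (bin n k) (no-over n k k<))
                               (cong suc (val-bin n k (<-trans ≤-refl k<)))

  no-over : ∀ n k → suc k < 2 ^ n → over true (bin n k) ≡ false
  no-over n k k< with over true (bin n k) in eq
  ... | false = refl
  ... | true  = contradiction (begin
      2 ^ n                        ≤⟨ m≤n+m (2 ^ n) _ ⟩
      val (inc true (bin n k)) + 2 ^ n ≡⟨ inc-wraps n (bin n k) (length-bin n k) eq ⟩
      suc (val (bin n k))          ≡⟨ cong suc (val-bin n k (<-trans ≤-refl k<)) ⟩
      suc k                        ∎) (<⇒≱ k<)
    where open ≤-Reasoning

over-last : ∀ n k → suc k ≡ 2 ^ n → over true (bin n k) ≡ true
over-last n k k≡ with over true (bin n k) in eq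
... | true  = refl
... | false = contradiction (val<2^ (inc true (bin n k))) (≤⇒≯ (≤-reflexive (begin
    2 ^ length (inc true (bin n k)) ≡⟨ cong (2 ^_) (length-bin n (suc k)) ⟩
    2 ^ n                           ≡⟨ sym k≡ ⟩
    suc k                           ≡⟨ cong suc (sym (val-bin n k (≤-reflexive k≡))) ⟩
    suc (val (bin n k))             ≡⟨ sym (inc-exact (bin n k) eq) ⟩
    val (inc true (bin n k))        ∎)))
  where open ≡-Reasoning

inc-last : ∀ n k → suc k ≡ 2 ^ n → inc true (bin n k) ≡ bin n 0
inc-last n k k≡ = trans (zeros (inc true (bin n k)) val≡0) (cong (λ m → replicate m false) (length-bin n (suc k)))
  where
  val≡0 : val (inc true (bin n k)) ≡ 0
  val≡0 = +-cancelʳ-≡ (2 ^ n) _ 0 (trans (inc-wraps n (bin n k) (length-bin n k) (over-last n k k≡))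
            (trans (cong suc (val-bin n k (≤-reflexive k≡))) k≡))

module _ (D : Lang) (x : Str) where
  private
    n : ℕ
    n = length (drop 1 x)

    D₂ : ℕ → ℕ → Bool
    D₂ y w = D (inter (bin n y) (bin n w))

  guess-out : ∀ {o} g → length g ≡ n → Leads D (guessing (carry true g) (reverse (fill true g)) []) o → Out O D x o
  guess-out {o} g |g| l = start (init-run x) (guess-leads g (drop 1 x) true [] |g| l)
    where
    start : ∀ {c c′} → Run D 1 c c′ → Leads D c′ o → Leads D c o
    start ((s , _) ◅ stay) = leads-step s

  module _ (y w : ℕ) where
    private
      g : List (Bool × Bool)
      g = zip (bin n y) (bin n w)
      cs : List Cell
      cs = fill true g
      same : length (bin n y) ≡ length (bin n w)
      same = trans (length-bin n y) (sym (length-bin n w))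
      ys≡ : ys g ≡ bin n y
      ys≡ = map-proj₁-zip (bin n y) (bin n w) same
      ws≡ : ws g ≡ bin n w
      ws≡ = map-proj₂-zip (bin n y) (bin n w) same
      |g| : length g ≡ n
      |g| = trans (length-zip-≡ (bin n y) (bin n w) same) (length-bin n y)
      twice : reverse (reverse cs) ≡ cs
      twice = reverse-involutive cs
      carry≡ : carry true g ≡ over true (bin n w)
      carry≡ = trans (carry≡over true g) (cong (over true) ws≡)
      query₁ : D (bits p₁ cs) ≡ D₂ y w
      query₁ = cong D (trans (bits₁ true g) (cong₂ inter ys≡ ws≡))
      query₂ : D (bits p₂ cs) ≡ D₂ y (suc w)
      query₂ = cong D (trans (bits₂ true g) (cong₂ inter ys≡ (cong (inc true) ws≡)))
      query₃ : D (bits p₃ cs) ≡ D₂ (suc w) (suc w)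
      query₃ = cong D (trans (bits₃ true g) (cong₂ inter (cong (inc true) ws≡) (cong (inc true) ws≡)))

      leads : ∀ {o} → Leads D (guessing (over true (bin n w)) (reverse cs) []) o → Out O D x o
      leads l = guess-out g |g| (subst (λ c → Leads D (guessing c (reverse cs) []) _) (sym carry≡) l)

      labels : Out O D x (label cs) → Out O D x acc ⊎ Out O D x rej
      labels = split (even (val (inc true (ws g)))) ∘ subst (Out O D x) (label-fill true g)
        where
        split : ∀ b → Out O D x (answer b) → Out O D x acc ⊎ Out O D x rej
        split true  = inj₁
        split false = inj₂

    jump-out : suc w < 2 ^ n → D₂ y w ≡ false → D₂ y (suc w) ≡ true → D₂ (suc w) (suc w) ≡ true →
               Out O D x acc ⊎ Out O D x rej
    jump-out w< q₁ q₂ q₃ = labels (leads (subst (λ c → Leads D (guessing c (reverse cs) []) (label cs)) (sym (no-over n w w<))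
      (leads-step (proj₁ (no-carry (reverse cs)))
        (subst (Leads D _) outcome (halts-leads (phase₁ (reverse cs)))))))
      where
      outcome : response {D} e₁ (D (bits p₁ (reverse (reverse cs)))) (reverse (reverse cs)) ≡ label cs
      outcome rewrite twice | trans query₁ q₁ | trans query₂ q₂ | trans query₃ q₃ = refl

    max-out : suc w ≡ 2 ^ n → D₂ y w ≡ false → Out O D x acc
    max-out w≡ q₁ = leads (subst (λ c → Leads D (guessing c (reverse cs) []) acc) (sym (over-last n w w≡))
      (leads-step (carry-max (reverse cs)) (subst (Leads D _) outcome (halts-leads (phaseₘ (reverse cs))))))
      where
      outcome : response {D} eₘ (D (bits p₁ (reverse (reverse cs)))) (reverse (reverse cs)) ≡ acc
      outcome rewrite twice | trans query₁ q₁ = refl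

    -- The sink `0` has no predecessor `w`, so its certificate is guessed through the wrap-around
    -- from `2ⁿ - 1`.
    zero-out : suc w ≡ 2 ^ n → D₂ 0 0 ≡ true → Out O D x acc ⊎ Out O D x rej
    zero-out w≡ q₃ = labels (leads (subst (λ c → Leads D (guessing c (reverse cs) []) (label cs)) (sym (over-last n w w≡))
      (leads-step (carry-zero (reverse cs)) (subst (Leads D _) outcome (halts-leads (phase₃ (reverse cs)))))))
      where
      query₀ : D (bits p₃ cs) ≡ D₂ 0 0
      query₀ = trans query₃ (cong (λ z → D (inter z z)) (inc-last n w w≡))
      outcome : response {D} e₃ (D (bits p₃ (reverse (reverse cs)))) (reverse (reverse cs)) ≡ label cs
      outcome rewrite twice | trans query₀ q₃ = refl

  -- Totality for an arbitrary oracle, honest or not. The invariant is a negative answer at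
  -- `(y , w)`, read as `f y > w`. If the answer at `(y , w + 1)` is negative too, `w` advances.
  -- Otherwise `w + 1` is a value of `f`: it is either a certified sink, or it becomes the new `y`
  -- with the invariant intact. Reaching `w = 2ⁿ - 1` exposes misbehaviour.
  walk : ∀ fuel y w → suc (fuel + w) ≡ 2 ^ n → D₂ y w ≡ false → Out O D x acc ⊎ Out O D x rej
  walk zero       y w end≡ q = inj₁ (max-out y w end≡ q)
  walk (suc fuel) y w end≡ q = onward (D₂ y (suc w)) refl (D₂ (suc w) (suc w)) refl
    where
    end≡′ : suc (fuel + suc w) ≡ 2 ^ n
    end≡′ = trans (cong suc (+-suc fuel w)) end≡
    onward : ∀ a → D₂ y (suc w) ≡ a → ∀ b → D₂ (suc w) (suc w) ≡ b → Out O D x acc ⊎ Out O D x rej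
    onward false q₂ _     _  = walk fuel y (suc w) end≡′ q₂
    onward true  q₂ false q₃ = walk fuel (suc w) (suc w) end≡′ q₃
    onward true  q₂ true  q₃ =
      jump-out y w (≤-trans (s≤s (m≤n+m (suc w) fuel)) (≤-reflexive end≡′)) q q₂ q₃

  O-overproductive : Out O D x acc ⊎ Out O D x rej
  O-overproductive = begin-at (D₂ 0 0) refl
    where
    1+pred : suc (pred (2 ^ n)) ≡ 2 ^ n
    1+pred = suc-pred (2 ^ n) {{m^n≢0 2 n}}
    begin-at : ∀ b → D₂ 0 0 ≡ b → Out O D x acc ⊎ Out O D x rej
    begin-at true  q = zero-out 0 (pred (2 ^ n)) 1+pred q
    begin-at false q = walk (pred (2 ^ n)) 0 0 (trans (cong suc (+-identityʳ _)) 1+pred) q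

answer-injective : ∀ {a b} → answer a ≡ answer b → a ≡ b
answer-injective {true}  {true}  _ = refl
answer-injective {false} {false} _ = refl

sound-answer : ∀ {a} b → Sound a (answer b) → b ≡ a
sound-answer true  (inj₂ eq) = answer-injective {true} eq
sound-answer false (inj₂ eq) = answer-injective {false} eq

language-≤O : ∀ I → language I ≤O oracle I
language-≤O I = O , (O-isNPTM , O-overproductive (oracle I) , under , decides) , O-overproductive
  where
  decides : Decides O (oracle I) (language I)
  decides x = mk⇔ forth (λ a → sym (sound-answer true (O-sound I x a)))
    where
    forth : language I x ≡ true → Out O (oracle I) x acc
    forth eq with O-overproductive (oracle I) x
    ... | inj₁ a = a
    ... | inj₂ r with () ← trans (sound-answer false (O-sound I x r)) eq
  under : Underproductive O (oracle I)
  under x (a , r) with () ← trans (sound-answer true (O-sound I x a)) (sym (sound-answer false (O-sound I x r)))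

theorem4p8 : ¬ (∀ (A B : Lang) → (A ≤RS B) ⇔ (A ≤O B))
theorem4p8 same = limit-≰RS (Equivalence.from (same (language limit) (oracle limit)) (language-≤O limit))
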